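{- Let $k\ge1$ be a fixed integer and $\rho\ge0$ an integer. Every connected graph $G$ with $n$ vertices and $\mathrm{tb}_k(G)\leq\rho$ admits a system $\mathcal{T}(G)$ of at most $k(1+\log_2 n)$ collective additive tree $(2\rho(1+\log_2 n))$-spanners, constructible in polynomial time (for every fixed $k$).
   Context: Graphs are finite, connected, unweighted, undirected and simple; $d_G$ is the shortest-path distance and $D_r(v,G)=\{u: d_G(u,v)\le r\}$. A tree-decomposition of $G=(V,E)$ is a pair $(\{X_i\mid i\in I\},T=(I,F))$ with $T$ a tree and bags $X_i\subseteq V$ such that (1) $\bigcup_i X_i=V$; (2) every edge lies in some bag; (3) for each $v\in V$ the nodes containing $v$ induce a connected subtree of $T$. Its $k$-breadth is the minimum integer $r$ such that every bag $X_i$ is contained in $D_r(v^i_1,G)\cup\dots\cup D_r(v^i_k,G)$ for some vertices $v^i_1,\dots,v^i_k$; $\mathrm{tb}_k(G)$ is the minimum $k$-breadth over all tree-decompositions of $G$. A graph $G$ admits a system of $\mu$ collective additive tree $r$-spanners if there is a set $\mathcal{T}(G)$ of at most $\mu$ spanning trees of $G$ such that for any two vertices $x,y$ some $T\in\mathcal{T}(G)$ satisfies $d_T(x,y)\le d_G(x,y)+r$. -}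

module Defs where

open import Data.Bool.Base using (Bool; true; false; T; if_then_else_)
open import Data.Bool.Properties using (T?)
open import Data.Fin.Base using (Fin)
open import Data.Fin.Properties using (any?; _≟_)
open import Data.Fin.Subset using (Subset; _∈_)
open import Data.List.Base using (List; []; _∷_; length; map; foldr; allFin)
open import Data.List.Relation.Unary.All using (All)
open import Data.List.Relation.Unary.Any using (Any)
open import Data.List.Relation.Unary.Unique.Propositional using (Unique)
open import Data.Nat.Base using (ℕ; zero; suc; _+_; _*_; _^_; _≤_; z≤n; s≤s; NonZero)
open import Data.Nat.Logarithm using (⌊log₂_⌋)
open import Data.Product.Base using (∃; _×_; _,_; proj₁; proj₂)
open import Level using (0ℓ)
open import Relation.Binary.Core using (Rel)
import Relation.Binary.Definitions as B
open import Relation.Binary.PropositionalEquality.Core using (_≡_; refl)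
open import Relation.Nullary.Decidable.Core using (yes; no; _×-dec_; map′)
open import Relation.Nullary.Negation.Core using (¬_; contradiction)
open import Relation.Unary using (Pred; Decidable)

IsMinimum : Pred ℕ 0ℓ → Pred ℕ 0ℓ
IsMinimum P m = P m × (∀ {j} → P j → m ≤ j)

IsMinimum-suc : {P : Pred ℕ 0ℓ} → ¬ P 0 → ∀ {m} →
                IsMinimum (λ j → P (suc j)) m → IsMinimum P (suc m)
IsMinimum-suc {P} ¬p₀ {m} (pₘ , min) = pₘ , lower
  where
  lower : ∀ {j} → P j → suc m ≤ j
  lower {zero}  p₀ = contradiction p₀ ¬p₀
  lower {suc j} pⱼ = s≤s (min pⱼ)

least : {P : Pred ℕ 0ℓ} → Decidable P → ∀ b → P b → ∃ (IsMinimum P)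
least P? zero    p = zero , p , λ _ → z≤n
least P? (suc b) p with P? zero
... | yes p₀ = zero , p₀ , λ _ → z≤n
... | no ¬p₀ with least (λ j → P? (suc j)) b p
...   | m , isMin = suc m , IsMinimum-suc ¬p₀ isMin

module _ {A : Set} where

  data Walk (R : Rel A 0ℓ) : A → A → ℕ → Set where
    []  : ∀ {u} → Walk R u u 0
    _∷_ : ∀ {u v w ℓ} → R u v → Walk R v w ℓ → Walk R u w (suc ℓ)

  vertices : ∀ {R u v ℓ} → Walk R u v ℓ → List A
  vertices {u = u} []      = u ∷ []
  vertices {u = u} (_ ∷ w) = u ∷ vertices w

walk? : ∀ {n} {R : Rel (Fin n) 0ℓ} → B.Decidable R →
        ∀ u v → Decidable (Walk R u v)
walk? {R = R} R? u v zero = map′ to from (u ≟ v)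
  where
  to : u ≡ v → Walk R u v 0
  to refl = []
  from : Walk R u v 0 → u ≡ v
  from [] = refl
walk? {R = R} R? u v (suc ℓ) =
  map′ to from (any? λ x → R? u x ×-dec walk? R? x v ℓ)
  where
  to : ∃ (λ x → R u x × Walk R x v ℓ) → Walk R u v (suc ℓ)
  to (_ , r , w) = r ∷ w
  from : Walk R u v (suc ℓ) → ∃ λ x → R u x × Walk R x v ℓ
  from (r ∷ w) = _ , r , w

-- Throughout, "graph" means nonempty connected finite simple graph, with
-- vertex set Fin n.
record Graph (n : ℕ) : Set where
  field
    adj       : Fin n → Fin n → Bool
    symmetric : ∀ u v → adj u v ≡ adj v u
    loopless  : ∀ u → adj u u ≡ false

  Adj : Rel (Fin n) 0ℓ
  Adj u v = T (adj u v)

  field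
    nonempty  : NonZero n
    connected : ∀ u v → ∃ (Walk Adj u v)

  shortest : ∀ u v → ∃ (IsMinimum (Walk Adj u v))
  shortest u v =
    least (walk? (λ x y → T? (adj x y)) u v)
          (proj₁ (connected u v)) (proj₂ (connected u v))

  dist : Fin n → Fin n → ℕ
  dist u v = proj₁ (shortest u v)

  dist-isMinimum : ∀ u v → IsMinimum (Walk Adj u v) (dist u v)
  dist-isMinimum u v = proj₂ (shortest u v)

  Disk : ℕ → Fin n → Pred (Fin n) 0ℓ
  Disk r v u = dist u v ≤ r

open Graph public

-- A cycle is a path u, …, v with at least three vertices, closed by an edge
-- from v back to u.
Acyclic : ∀ {n} → Graph n → Set
Acyclic G = ∀ {u v ℓ} (w : Walk (Adj G) u v ℓ) →
            Unique (vertices w) → 2 ≤ ℓ → ¬ Adj G v u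

IsSpanningTree : ∀ {n} → Graph n → Graph n → Set
IsSpanningTree G T = Acyclic T × (∀ {u v} → Adj T u v → Adj G u v)

record TreeDecomposition {n} (G : Graph n) : Set where
  field
    {size}         : ℕ
    tree           : Graph size
    tree-acyclic   : Acyclic tree
    bag            : Fin size → Subset n
    covers-vertex  : ∀ v → ∃ λ i → v ∈ bag i
    covers-edge    : ∀ {u v} → Adj G u v → ∃ λ i → u ∈ bag i × v ∈ bag i
    -- the nodes whose bags contain v induce a connected subgraph of the tree
    bags-connected : ∀ v {i j} → v ∈ bag i → v ∈ bag j →
      ∃ (Walk (λ a b → Adj tree a b × v ∈ bag a × v ∈ bag b) i j)

open TreeDecomposition public

BagsCovered : ∀ {n} (k : ℕ) {G : Graph n} → TreeDecomposition G → Pred ℕ 0ℓ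
BagsCovered {n} k {G} D r =
  ∀ i → ∃ λ (c : Fin k → Fin n) →
    ∀ {u} → u ∈ bag D i → ∃ λ j → Disk G r (c j) u

IsBreadth : ∀ {n} (k : ℕ) {G : Graph n} → TreeDecomposition G → Pred ℕ 0ℓ
IsBreadth k D = IsMinimum (BagsCovered k D)

IsTreeBreadth : ∀ {n} (k : ℕ) → Graph n → Pred ℕ 0ℓ
IsTreeBreadth k G =
  IsMinimum λ r → ∃ λ (D : TreeDecomposition G) → IsBreadth k D r

record IsCollectiveTreeSpanners {n} (G : Graph n) (μ r : ℕ)
                                (𝒯 : List (Graph n)) : Set where
  field
    bounded  : length 𝒯 ≤ μ
    spanning : All (IsSpanningTree G) 𝒯
    stretch  : ∀ x y → Any (λ T → dist T x y ≤ dist G x y + r) 𝒯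

-- ⌊ c · (1 + log₂ n) ⌋ for n ≥ 1, with the real logarithm:
-- c · (1 + log₂ n) = log₂ ((2n)ᶜ).
⌊_·[1+log₂_]⌋ : ℕ → ℕ → ℕ
⌊ c ·[1+log₂ n ]⌋ = ⌊log₂ ((2 * n) ^ c) ⌋

-- Computation model: while-programs on a single register holding a binary
-- tree (N. D. Jones's language I, together with a conditional).  Every
-- operation has unit cost; with trees stored as shared pointer structures it
-- takes constant time on a pointer machine, so that polynomial time here
-- agrees with polynomial time on Turing machines for outputs whose tree has
-- polynomial size.

infixr 5 _∙_

data Tree : Set where
  nil : Tree
  _∙_ : Tree → Tree → Tree

data Expr : Set where
  reg nil : Expr
  cons    : Expr → Expr → Expr
  hd tl   : Expr → Expr

head tail : Tree → Tree
head nil     = nil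
head (a ∙ _) = a
tail nil     = nil
tail (_ ∙ b) = b

⟦_⟧ : Expr → Tree → Tree
⟦ reg      ⟧ d = d
⟦ nil      ⟧ d = nil
⟦ cons e f ⟧ d = ⟦ e ⟧ d ∙ ⟦ f ⟧ d
⟦ hd e     ⟧ d = head (⟦ e ⟧ d)
⟦ tl e     ⟧ d = tail (⟦ e ⟧ d)

cost : Expr → ℕ
cost reg        = 1
cost nil        = 1
cost (cons e f) = suc (cost e + cost f)
cost (hd e)     = suc (cost e)
cost (tl e)     = suc (cost e)

infixr 4 _⨾_

data Program : Set where
  reg≔_          : Expr → Program
  _⨾_            : Program → Program → Program
  cond           : Expr → Program → Program → Program
  while_loop_    : Expr → Program → Program

-- c ⊢ d ⇓ d′ [ t ]: started with register d, the program c halts with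
-- register d′ after t steps.  A test succeeds when its value is not nil.
infix 3 _⊢_⇓_[_]

data _⊢_⇓_[_] : Program → Tree → Tree → ℕ → Set where
  assign : ∀ {e d} → reg≔ e ⊢ d ⇓ ⟦ e ⟧ d [ suc (cost e) ]
  seq    : ∀ {p q d d′ d″ s t} →
           p ⊢ d ⇓ d′ [ s ] → q ⊢ d′ ⇓ d″ [ t ] →
           p ⨾ q ⊢ d ⇓ d″ [ suc (s + t) ]
  true   : ∀ {e p q d d′ a b t} →
           ⟦ e ⟧ d ≡ a ∙ b → p ⊢ d ⇓ d′ [ t ] →
           cond e p q ⊢ d ⇓ d′ [ suc (cost e + t) ]
  false  : ∀ {e p q d d′ t} →
           ⟦ e ⟧ d ≡ nil → q ⊢ d ⇓ d′ [ t ] →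
           cond e p q ⊢ d ⇓ d′ [ suc (cost e + t) ]
  stop   : ∀ {e p d} →
           ⟦ e ⟧ d ≡ nil →
           while e loop p ⊢ d ⇓ d [ suc (cost e) ]
  again  : ∀ {e p d d′ d″ a b s t} →
           ⟦ e ⟧ d ≡ a ∙ b →
           p ⊢ d ⇓ d′ [ s ] → while e loop p ⊢ d′ ⇓ d″ [ t ] →
           while e loop p ⊢ d ⇓ d″ [ suc (cost e + (s + t)) ]

_⊢_⇓_within_ : Program → Tree → Tree → ℕ → Set
p ⊢ d ⇓ d′ within b = ∃ λ t → t ≤ b × p ⊢ d ⇓ d′ [ t ]

encodeList : List Tree → Tree
encodeList = foldr _∙_ nil

encodeBool : Bool → Tree
encodeBool b = if b then nil ∙ nil else nil

encodeGraph : ∀ {n} → Graph n → Tree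
encodeGraph {n} G =
  encodeList (map (λ u → encodeList (map (λ v → encodeBool (adj G u v))
                                         (allFin n)))
                  (allFin n))

encodeGraphs : ∀ {n} → List (Graph n) → Tree
encodeGraphs 𝒯 = encodeList (map encodeGraph 𝒯)

-- Let A be the set of vertices that are still alive, initially all of them.
-- For every component C of G[A], take the least r and vertices v₁, …, vₖ of G
-- such that removing the disks of radius r around them, measured in G and not
-- in G[A], leaves components of at most |C| / 2 vertices.  Some bag of a tree
-- decomposition is such a separator, so that r ≤ ρ.  For each i ≤ k the
-- breadth-first trees of G[A] from the centres vᵢ that lie in their own
-- components form a forest, which is extended to a spanning tree of G.  Then
-- the disks are removed from A.  After at most 1 + log₂ n rounds A is empty.
--
-- A vertex u removed in round ℓ has a walk of length at most ρ to a centre vᵢ.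
-- Either the walk stays in A, and the tree of vᵢ serves every walk through A
-- that ends in u; or it meets a vertex removed earlier, and u inherits the tree
-- of that vertex at an additional cost of ρ.  Hence u is within ρ (ℓ + 1) of a
-- root.  A shortest path from x to y is cut by the first round that removes one
-- of its vertices, and the tree serving this vertex joins x to y with an
-- additive error of at most 2 ρ (ℓ + 1).
module Submission where

open import Defs
open import Data.Bool.Base using (Bool; true; false; if_then_else_; not; _∧_; _∨_; T)
open import Data.Bool.Properties using (T-∧; T-∨; T?)
open import Data.Fin.Base using (Fin; zero; suc; toℕ; fromℕ; inject₁)
open import Data.Fin.Properties
  using (toℕ-fromℕ; toℕ-inject₁; toℕ≤n; toℕ-injective; _≟_; injective⇒≤; any?)
import Data.Fin.Subset as Subset
open import Data.List.Base using (List; []; _∷_; length; map; tabulate; allFin; lookup; _++_)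
open import Data.List.Membership.DecPropositional using (_∈?_)
open import Data.List.Membership.Propositional using (_∈_; _∉_)
open import Data.List.Membership.Propositional.Properties using (∈-lookup; ∈-allFin)
open import Data.List.Properties using (length-map; length-++; length-tabulate; map-++; map-∘)
import Data.List.Relation.Unary.All as All
open import Data.List.Relation.Unary.All using (All; []; _∷_)
import Data.List.Relation.Unary.All.Properties as All
open import Data.List.Relation.Unary.All.Properties using (¬Any⇒All¬)
open import Data.List.Relation.Unary.AllPairs using ([]; _∷_)
import Data.List.Relation.Unary.Any as Any
open import Data.List.Relation.Unary.Any using (here; there; Any)
import Data.List.Relation.Unary.Any.Properties as Any
open import Data.List.Relation.Unary.Unique.Propositional using (Unique)
open import Data.List.Relation.Unary.Unique.Propositional.Properties using (Unique[x∷xs]⇒x∉xs)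
open import Data.Maybe.Base using (Maybe; just; nothing; maybe′)
open import Data.Nat.Base
  using (ℕ; zero; suc; pred; _+_; _*_; _∸_; _^_; _⊓_; _≤_; _<_; _≡ᵇ_; z≤n; s≤s; NonZero)
open import Data.Nat.Logarithm using (⌊log₂_⌋; ⌊log₂⌋-mono-≤; ⌊log₂[2^n]⌋≡n)
open import Data.Nat.Properties hiding (_≟_)
open import Data.Nat.Tactic.RingSolver using (solve-∀)
open import Data.Product.Base using (∃; ∃₂; _×_; _,_; proj₁; proj₂)
open import Data.Sum.Base using (_⊎_; inj₁; inj₂)
open import Data.Unit.Base using (⊤; tt)
open import Function.Base using (_∘_; id)
open import Function.Bundles using (Equivalence)
open import Level using (0ℓ)
open import Relation.Binary.Construct.Closure.ReflexiveTransitive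
  using (Star; ε; _◅_; _◅◅_; gmap; reverse) renaming (fold to star-fold)
open import Relation.Binary.Core using (Rel)
open import Relation.Binary.PropositionalEquality hiding ([_])
open import Relation.Binary.Structures using (IsEquivalence)
open import Relation.Nullary.Decidable.Core using (yes; no; ⌊_⌋; toWitness; fromWitness)
open import Relation.Nullary.Negation.Core using (contradiction; ¬_)

-- Routines with polynomial time bounds

-- Polynomial time shapes the development: everything must in the end run on one register holding a
-- bare tree. Each algorithmic notion is therefore an ordinary function on Boolean matrices whose
-- iterations are folds over the vertices, and it is later mirrored by a `Fun` whose code is bounded
-- by a constant times a power of n. A loop over the vertices raises the exponent by one; the choice
-- of k centres is k nested loops, and this is where k must be fixed.
--
-- The breadth is not an input and no decomposition is ever computed. The search tries the radii
-- below n in increasing order, and a bag of some decomposition merely witnesses that it succeeds in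
-- time. Disks are measured in G because the covering of the bags is: this makes one decomposition
-- of G a witness for every component of every G[A], at the price of centres outside the component.
--
-- Forests carry an explicit connectivity matrix, and acyclicity takes the form that every edge is a
-- bridge. This form survives the insertion of an edge between two classes, and it also drives the
-- descent in the decomposition tree.

infixr 4 _then_

data Routine : Set where
  assignment : Expr → Routine
  _then_     : Routine → Routine → Routine
  branch     : Routine → Routine → Routine
  counting   : Routine → Routine

program : Routine → Program
program (assignment e) = reg≔ e
program (r then r′)    = program r ⨾ program r′
program (branch r r′)  = cond (hd (hd reg)) (program r) (program r′)
program (counting r)   = while hd (hd reg) loop program r

-- The time bound is `factor r * n ^ exponent r`. Each 4 is one evaluation of the test
-- `hd (hd reg)`, including the step for the test itself; a loop pays it once per round and once
-- more for the failing test. Exponents are added rather than maximised, which is harmless because n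
-- is at least 1.
factor : Routine → ℕ
factor (assignment e) = suc (cost e)
factor (r then r′)    = 1 + (factor r + factor r′)
factor (branch r r′)  = 4 + (factor r + factor r′)
factor (counting r)   = 4 + (4 + factor r)

exponent : Routine → ℕ
exponent (assignment e) = 0
exponent (r then r′)    = exponent r + exponent r′
exponent (branch r r′)  = exponent r + exponent r′
exponent (counting r)   = suc (exponent r)

record Halts (r : Routine) (n : ℕ) (d v : Tree) : Set where
  constructor halts
  field
    {steps}  : ℕ
    steps≤   : steps ≤ factor r * n ^ exponent r
    computes : program r ⊢ d ⇓ v [ steps ]

open Halts

-- The register holds the argument on top of a stack that a routine leaves
-- untouched.
record Runs (r : Routine) (n : ℕ) (d v : Tree) : Set where
  constructor runs
  field
    run : ∀ s → Halts r n (d ∙ s) (v ∙ s)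

open Runs

module _ (n : ℕ) .{{_ : NonZero n}} where

  1≤n^ : ∀ e → 1 ≤ n ^ e
  1≤n^ e = m^n>0 n e

  const≤ : ∀ c e → c ≤ c * n ^ e
  const≤ c e = subst (_≤ c * n ^ e) (*-identityʳ c) (*-monoʳ-≤ c (1≤n^ e))

  raiseˡ : ∀ c e f → c * n ^ e ≤ c * n ^ (e + f)
  raiseˡ c e f = *-monoʳ-≤ c (^-monoʳ-≤ n (m≤m+n e f))

  raiseʳ : ∀ c e f → c * n ^ e ≤ c * n ^ (f + e)
  raiseʳ c e f = *-monoʳ-≤ c (^-monoʳ-≤ n (m≤n+m e f))

  add-bounds : ∀ c c′ k e f {a b} → a ≤ c * n ^ e → b ≤ c′ * n ^ f →
               k + (a + b) ≤ (k + (c + c′)) * n ^ (e + f)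
  add-bounds c c′ k e f {a} {b} p q = begin
    k + (a + b)
      ≤⟨ +-mono-≤ (const≤ k (e + f))
           (+-mono-≤ (≤-trans p (raiseˡ c e f)) (≤-trans q (raiseʳ c′ f e))) ⟩
    k * n ^ (e + f) + (c * n ^ (e + f) + c′ * n ^ (e + f))
      ≡⟨ cong (k * n ^ (e + f) +_) (*-distribʳ-+ (n ^ (e + f)) c c′) ⟨
    k * n ^ (e + f) + (c + c′) * n ^ (e + f)
      ≡⟨ *-distribʳ-+ (n ^ (e + f)) k (c + c′) ⟨
    (k + (c + c′)) * n ^ (e + f) ∎
    where open ≤-Reasoning

  add-const : ∀ c k e {a} → a ≤ c * n ^ e → k + a ≤ (k + c) * n ^ e
  add-const c k e {a} p = begin
    k + a                       ≤⟨ +-mono-≤ (const≤ k e) p ⟩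
    k * n ^ e + c * n ^ e       ≡⟨ *-distribʳ-+ (n ^ e) k c ⟨
    (k + c) * n ^ e             ∎
    where open ≤-Reasoning

module _ {n : ℕ} .{{_ : NonZero n}} where

  infixr 4 _then-halts_
  _then-halts_ : ∀ {r r′ d v w} → Halts r n d v → Halts r′ n v w →
                 Halts (r then r′) n d w
  _then-halts_ {r} {r′} (halts a≤ p) (halts b≤ q) =
    halts (add-bounds n (factor r) (factor r′) 1 (exponent r) (exponent r′) a≤ b≤) (seq p q)

  infixr 4 _then-runs_
  _then-runs_ : ∀ {r r′ d v w} → Runs r n d v → Runs r′ n v w →
                Runs (r then r′) n d w
  run (R then-runs R′) s = run R s then-halts run R′ s

onTop : Expr → Expr
onTop reg        = hd reg
onTop nil        = nil
onTop (cons e f) = cons (onTop e) (onTop f)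
onTop (hd e)     = hd (onTop e)
onTop (tl e)     = tl (onTop e)

⟦onTop⟧ : ∀ e {d s} → ⟦ onTop e ⟧ (d ∙ s) ≡ ⟦ e ⟧ d
⟦onTop⟧ reg        = refl
⟦onTop⟧ nil        = refl
⟦onTop⟧ (cons e f) = cong₂ _∙_ (⟦onTop⟧ e) (⟦onTop⟧ f)
⟦onTop⟧ (hd e)     = cong head (⟦onTop⟧ e)
⟦onTop⟧ (tl e)     = cong tail (⟦onTop⟧ e)

eval : Expr → Routine
eval e = assignment (cons (onTop e) (tl reg))

assignment-halts : ∀ e {n d} → Halts (assignment e) n d (⟦ e ⟧ d)
assignment-halts e = halts (≤-reflexive (sym (*-identityʳ (suc (cost e))))) assign

eval-runs : ∀ e {n d} → Runs (eval e) n d (⟦ e ⟧ d)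
run (eval-runs e {n} {d}) s =
  subst (λ v → Halts (eval e) n (d ∙ s) (v ∙ s)) (⟦onTop⟧ e)
        (assignment-halts (cons (onTop e) (tl reg)))

-- A routine consumes its argument, so a copy is pushed beforehand. After `r` the copy is brought to
-- the top and the first result waits on the stack while `r′` runs.
both : Routine → Routine → Routine
both r r′ = assignment (cons (hd reg) reg)
       then r
       then assignment (cons (hd (tl reg)) (cons (hd reg) (tl (tl reg))))
       then r′
       then assignment (cons (cons (hd (tl reg)) (hd reg)) (tl (tl reg)))

module _ {n : ℕ} .{{_ : NonZero n}} where

  both-runs : ∀ {r r′ d v w} → Runs r n d v → Runs r′ n d w →
              Runs (both r r′) n d (v ∙ w)
  run (both-runs {v = v} R R′) s =
    assignment-halts (cons (hd reg) reg)
      then-halts run R _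
      then-halts assignment-halts (cons (hd (tl reg)) (cons (hd reg) (tl (tl reg))))
      then-halts run R′ (v ∙ s)
      then-halts assignment-halts (cons (cons (hd (tl reg)) (hd reg)) (tl (tl reg)))

  branch-∙ : ∀ {r r′ a b d v} → Runs r n ((a ∙ b) ∙ d) v →
             Runs (branch r r′) n ((a ∙ b) ∙ d) v
  run (branch-∙ {r} {r′} R) s with run R s
  ... | halts t≤ p =
    halts (≤-trans (+-monoʳ-≤ 4 (m≤m+n _ 0))
             (add-bounds n (factor r) (factor r′) 4 (exponent r) (exponent r′) t≤ z≤n))
          (Defs.true refl p)

  branch-nil : ∀ {r r′ d v} → Runs r′ n (nil ∙ d) v →
               Runs (branch r r′) n (nil ∙ d) v
  run (branch-nil {r} {r′} R) s with run R s
  ... | halts t≤ p =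
    halts (add-bounds n (factor r) (factor r′) 4 (exponent r) (exponent r′) z≤n t≤)
          (Defs.false refl p)

unary : ℕ → Tree
unary zero    = nil
unary (suc m) = nil ∙ unary m

-- The argument c ∙ (s ∙ d) consists of a counter, the state of the loop and
-- the environment of its body.
round : Routine → Routine
round r = eval (cons (tl (hd reg)) (tl reg))
     then both (eval reg) r
     then eval (cons (hd (hd reg)) (cons (tl reg) (tl (tl (hd reg)))))

repeat : Routine → Routine
repeat r = counting (round r) then eval (hd (tl reg))

fold : ∀ {S : Set} {m} → (Fin m → S → S) → S → S
fold {m = zero}  f s = s
fold {m = suc m} f s = f zero (fold (λ i → f (suc i)) s)

-- The machine counts down and so treats the largest index in its first round, which is the
-- innermost application in `fold`. Splitting at this end lets the induction follow the machine.
fold-last : ∀ {S : Set} {m} (f : Fin (suc m) → S → S) s →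
            fold f s ≡ fold (λ i → f (inject₁ i)) (f (fromℕ m) s)
fold-last {m = zero}  f s = refl
fold-last {m = suc m} f s = cong (f zero) (fold-last (λ i → f (suc i)) s)

data Iterates (r : Routine) (n : ℕ) : ℕ → Tree → Tree → Set where
  done : ∀ {d} → head (head d) ≡ nil → Iterates r n 0 d d
  next : ∀ {m d d′ d″ a b} → head (head d) ≡ a ∙ b → Halts r n d d′ →
         Iterates r n m d′ d″ → Iterates r n (suc m) d d″

module _ {n : ℕ} .{{_ : NonZero n}} where

  iterates-steps : ∀ {r m d d′} → Iterates r n m d d′ →
                   program (counting r) ⊢ d ⇓ d′ within (4 + m * (4 + factor r * n ^ exponent r))
  iterates-steps (done eq) = 4 , ≤-refl , stop eq
  iterates-steps {r} {suc m} (next eq (halts {a} a≤ p) ps) =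
    let b , b≤ , q = iterates-steps ps in 4 + (a + b) , bound b≤ , again eq p q
    where
    K = factor r * n ^ exponent r
    bound : ∀ {b} → b ≤ 4 + m * (4 + K) → 4 + (a + b) ≤ 4 + (4 + K + m * (4 + K))
    bound {b} b≤ = begin
      4 + (a + b)                   ≤⟨ +-monoʳ-≤ 4 (+-mono-≤ a≤ b≤) ⟩
      4 + (K + (4 + m * (4 + K)))   ≡⟨ cong (4 +_) (+-assoc K 4 _) ⟨
      4 + (K + 4 + m * (4 + K))     ≡⟨ cong (λ z → 4 + (z + m * (4 + K))) (+-comm K 4) ⟩
      4 + (4 + K + m * (4 + K))     ∎
      where open ≤-Reasoning

  counting-halts : ∀ {r m d d′} → m ≤ n → Iterates r n m d d′ → Halts (counting r) n d d′
  counting-halts {r} {m} m≤n ps =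
    let _ , t≤ , p = iterates-steps ps in halts (≤-trans t≤ bound) p
    where
    b = factor r
    e = exponent r
    bound : 4 + m * (4 + b * n ^ e) ≤ (4 + (4 + b)) * n ^ suc e
    bound = add-const n (4 + b) 4 (suc e) (begin
      m * (4 + b * n ^ e)       ≤⟨ *-mono-≤ m≤n (add-const n b 4 e ≤-refl) ⟩
      n * ((4 + b) * n ^ e)     ≡⟨ *-assoc n (4 + b) (n ^ e) ⟨
      n * (4 + b) * n ^ e       ≡⟨ cong (_* n ^ e) (*-comm n (4 + b)) ⟩
      (4 + b) * n * n ^ e       ≡⟨ *-assoc (4 + b) n (n ^ e) ⟩
      (4 + b) * (n * n ^ e)     ∎)
      where open ≤-Reasoning

  round-runs : ∀ {r a c s d v} → Runs r n (c ∙ (s ∙ d)) v →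
               Runs (round r) n ((a ∙ c) ∙ (s ∙ d)) (c ∙ (v ∙ d))
  round-runs R =
    eval-runs (cons (tl (hd reg)) (tl reg))
      then-runs both-runs (eval-runs reg) R
      then-runs eval-runs (cons (hd (hd reg)) (cons (tl reg) (tl (tl (hd reg)))))

  module _ {S : Set} (code : S → Tree) {r : Routine} {d : Tree} where

    fold-iterates : ∀ {m} (f : Fin m → S → S) →
      (∀ i s → Runs r n (unary (toℕ i) ∙ (code s ∙ d)) (code (f i s))) →
      ∀ s k → Iterates (round r) n m ((unary m ∙ (code s ∙ d)) ∙ k)
                                     ((nil ∙ (code (fold f s) ∙ d)) ∙ k)
    fold-iterates {zero}  f body s k = done refl
    fold-iterates {suc m} f body s k =
      subst (λ v → Iterates (round r) n (suc m) ((unary (suc m) ∙ (code s ∙ d)) ∙ k)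
                                                ((nil ∙ (code v ∙ d)) ∙ k))
        (sym (fold-last f s))
        (next refl
          (run (round-runs (subst (λ i → Runs r n (unary i ∙ (code s ∙ d)) (code (f (fromℕ m) s)))
                                  (toℕ-fromℕ m) (body (fromℕ m) s))) k)
          (fold-iterates (λ i → f (inject₁ i))
            (λ i t → subst (λ j → Runs r n (unary j ∙ (code t ∙ d)) (code (f (inject₁ i) t)))
                           (toℕ-inject₁ i) (body (inject₁ i) t))
            (f (fromℕ m) s) k))

    repeat-runs : ∀ {m} (f : Fin m → S → S) → m ≤ n →
      (∀ i s → Runs r n (unary (toℕ i) ∙ (code s ∙ d)) (code (f i s))) →
      ∀ {s} → Runs (repeat r) n (unary m ∙ (code s ∙ d)) (code (fold f s))
    repeat-runs f m≤n body {s} =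
      runs (λ k → counting-halts m≤n (fold-iterates f body s k))
        then-runs eval-runs (hd (tl reg))

private
  shift : Expr
  shift = cons (cons (tl (hd (hd reg)))
                     (cons (hd (tl (hd reg))) (cons nil (tl (tl (hd reg)))))) nil

-- Environments must end with the unary size, but the input is only an adjacency matrix. The size is
-- read off as the number of its rows: each round drops one row and increments the counter.
measure : Routine
measure = assignment (cons (cons reg (cons reg nil)) nil)
     then counting (assignment shift)
     then assignment (cons (tl (hd reg)) nil)

measure-halts : ∀ {n} .{{_ : NonZero n}} ts → length ts ≡ n →
                Halts measure n (encodeList ts) ((encodeList ts ∙ unary n) ∙ nil)
measure-halts {n} ts refl =
  assignment-halts (cons (cons reg (cons reg nil)) nil)
    then-halts counting-halts ≤-refl
      (subst (λ m → Iterates (assignment shift) n n (state ts 0) (state [] m))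
             (+-identityʳ n) (count-up ts 0))
    then-halts assignment-halts (cons (tl (hd reg)) nil)
  where
  state : List Tree → ℕ → Tree
  state us m = (encodeList us ∙ (encodeList ts ∙ unary m)) ∙ nil
  count-up : ∀ us m → Iterates (assignment shift) n (length us)
                        (state us m) (state [] (length us + m))
  count-up []       m = done refl
  count-up (_ ∷ us) m = next refl (assignment-halts shift)
    (subst (λ l → Iterates (assignment shift) n (length us) (state us (suc m)) (state [] l))
           (+-suc (length us) m) (count-up us (suc m)))

-- A language of functions on the vertices of a graph

infixr 6 _×ᵗ_

data Ty : Set where
  bool nat vertex  : Ty
  table maybe list : Ty → Ty
  _×ᵗ_             : Ty → Ty → Ty

⟪_⟫ : Ty → ℕ → Set
⟪ bool    ⟫ n = Bool
⟪ nat     ⟫ n = ℕ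
⟪ vertex  ⟫ n = Fin n
⟪ table τ ⟫ n = Fin n → ⟪ τ ⟫ n
⟪ maybe τ ⟫ n = Maybe (⟪ τ ⟫ n)
⟪ list τ  ⟫ n = List (⟪ τ ⟫ n)
⟪ σ ×ᵗ τ  ⟫ n = ⟪ σ ⟫ n × ⟪ τ ⟫ n

encode : ∀ τ {n} → ⟪ τ ⟫ n → Tree
encode bool      b        = encodeBool b
encode nat       m        = unary m
encode vertex    u        = unary (toℕ u)
encode (table τ) {n} f    = encodeList (map (λ u → encode τ (f u)) (allFin n))
encode (maybe τ) nothing  = nil
encode (maybe τ) (just x) = encode τ x ∙ nil
encode (list τ)  []       = nil
encode (list τ)  (x ∷ xs) = encode τ x ∙ encode (list τ) xs
encode (σ ×ᵗ τ)  (x , y)  = encode σ x ∙ encode τ y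

Env : List Ty → ℕ → Set
Env []      n = ⊤
Env (τ ∷ Γ) n = ⟪ τ ⟫ n × Env Γ n

-- Every environment ends with n, which controls the loops over the vertices.
encodeEnv : ∀ Γ {n} → Env Γ n → Tree
encodeEnv []      {n} _       = unary n
encodeEnv (τ ∷ Γ)     (x , γ) = encode τ x ∙ encodeEnv Γ γ

-- As all loops run over the vertices, the time bound depends on n alone and
-- not on the size of the argument.
record Fun (Γ : List Ty) (τ : Ty) : Set where
  field
    value   : ∀ {n} → Env Γ n → ⟪ τ ⟫ n
    code    : Routine
    correct : ∀ {n} .{{_ : NonZero n}} (γ : Env Γ n) →
              Runs code n (encodeEnv Γ γ) (encode τ (value γ))

open Fun

data _∋_ : List Ty → Ty → Set where
  here  : ∀ {Γ τ} → (τ ∷ Γ) ∋ τ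
  there : ∀ {Γ σ τ} → Γ ∋ τ → (σ ∷ Γ) ∋ τ

fetch : ∀ {Γ τ n} → Γ ∋ τ → Env Γ n → ⟪ τ ⟫ n
fetch here      (x , _) = x
fetch (there i) (_ , γ) = fetch i γ

access : ∀ {Γ τ} → Γ ∋ τ → Expr → Expr
access here      e = hd e
access (there i) e = access i (tl e)

⟦access⟧ : ∀ {Γ τ n} (i : Γ ∋ τ) (γ : Env Γ n) e {d} → ⟦ e ⟧ d ≡ encodeEnv Γ γ →
           ⟦ access i e ⟧ d ≡ encode τ (fetch i γ)
⟦access⟧ here      γ e eq = cong head eq
⟦access⟧ (there i) γ e eq = ⟦access⟧ i (proj₂ γ) (tl e) (cong tail eq)

var : ∀ {Γ τ} → Γ ∋ τ → Fun Γ τ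
var i .value γ = fetch i γ
var i .code = eval (access i reg)
var i .correct γ = subst (Runs _ _ _) (⟦access⟧ i γ reg refl) (eval-runs (access i reg))

pattern #0 = here
pattern #1 = there #0
pattern #2 = there #1
pattern #3 = there #2
pattern #4 = there #3
pattern #5 = there #4

sizeExpr : List Ty → Expr → Expr
sizeExpr []      e = e
sizeExpr (_ ∷ Γ) e = sizeExpr Γ (tl e)

⟦sizeExpr⟧ : ∀ Γ {n} (γ : Env Γ n) e {d} → ⟦ e ⟧ d ≡ encodeEnv Γ γ →
             ⟦ sizeExpr Γ e ⟧ d ≡ unary n
⟦sizeExpr⟧ []      γ e eq = eq
⟦sizeExpr⟧ (_ ∷ Γ) γ e eq = ⟦sizeExpr⟧ Γ (proj₂ γ) (tl e) (cong tail eq)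

size-runs : ∀ Γ {n} (γ : Env Γ n) → Runs (eval (sizeExpr Γ reg)) n (encodeEnv Γ γ) (unary n)
size-runs Γ γ = subst (Runs _ _ _) (⟦sizeExpr⟧ Γ γ reg refl) (eval-runs (sizeExpr Γ reg))

data Args (Γ : List Ty) : List Ty → Set where
  []  : Args Γ []
  _∷_ : ∀ {τ Δ} → Fun Γ τ → Args Γ Δ → Args Γ (τ ∷ Δ)

values : ∀ {Γ Δ n} → Args Γ Δ → Env Γ n → Env Δ n
values []       γ = tt
values (F ∷ Fs) γ = value F γ , values Fs γ

argsCode : ∀ {Γ Δ} → Args Γ Δ → Routine
argsCode {Γ} []       = eval (sizeExpr Γ reg)
argsCode     (F ∷ Fs) = both (code F) (argsCode Fs)

args-runs : ∀ {Γ Δ n} .{{_ : NonZero n}} (Fs : Args Γ Δ) (γ : Env Γ n) →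
            Runs (argsCode Fs) n (encodeEnv Γ γ) (encodeEnv Δ (values Fs γ))
args-runs {Γ} []       γ = size-runs Γ γ
args-runs     (F ∷ Fs) γ = both-runs (correct F γ) (args-runs Fs γ)

call : ∀ {Γ Δ τ} → Fun Δ τ → Args Γ Δ → Fun Γ τ
call F Fs .value γ = value F (values Fs γ)
call F Fs .code = argsCode Fs then code F
call F Fs .correct γ = args-runs Fs γ then-runs correct F (values Fs γ)

-- The code stays and only its specification changes, so that values of compound programs agree
-- definitionally with the functions that the correctness proof reasons about.
revalue : ∀ {Γ τ} (F : Fun Γ τ) (f : ∀ {n} → Env Γ n → ⟪ τ ⟫ n) →
          (∀ {n} (γ : Env Γ n) → value F γ ≡ f γ) → Fun Γ τ
revalue F f eq .value = f
revalue F f eq .code = code F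
revalue F f eq .correct γ = subst (λ v → Runs _ _ _ (encode _ v)) (eq γ) (correct F γ)

module _ {Γ : List Ty} where

  constant : ∀ {τ} (e : Expr) (x : ∀ {n} → ⟪ τ ⟫ n) →
             (∀ {n d} → ⟦ e ⟧ d ≡ encode τ (x {n})) → Fun Γ τ
  constant e x eq .value _ = x
  constant e x eq .code = eval e
  constant e x eq .correct {n} γ = subst (Runs _ n _) eq (eval-runs e)

  trueᶠ falseᶠ : Fun Γ bool
  trueᶠ = constant (cons nil nil) true refl
  falseᶠ = constant nil false refl

  zeroᶠ : Fun Γ nat
  zeroᶠ = constant nil 0 refl

  nothingᶠ : ∀ {τ} → Fun Γ (maybe τ)
  nothingᶠ = constant nil nothing refl

  []ᶠ : ∀ {τ} → Fun Γ (list τ)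
  []ᶠ = constant nil [] refl

  after : ∀ {σ τ} (e : Expr) (f : ∀ {n} → ⟪ σ ⟫ n → ⟪ τ ⟫ n) →
          (∀ {n} (x : ⟪ σ ⟫ n) → ⟦ e ⟧ (encode σ x) ≡ encode τ (f x)) →
          Fun Γ σ → Fun Γ τ
  after e f eq F .value γ = f (value F γ)
  after e f eq F .code = code F then eval e
  after e f eq F .correct γ =
    correct F γ then-runs subst (Runs _ _ _) (eq (value F γ)) (eval-runs e)

  sucᶠ predᶠ : Fun Γ nat → Fun Γ nat
  sucᶠ = after (cons nil reg) suc (λ _ → refl)
  predᶠ = after (tl reg) pred (λ { zero → refl ; (suc _) → refl })

  fst : ∀ {σ τ} → Fun Γ (σ ×ᵗ τ) → Fun Γ σ
  fst = after (hd reg) proj₁ (λ _ → refl)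

  snd : ∀ {σ τ} → Fun Γ (σ ×ᵗ τ) → Fun Γ τ
  snd = after (tl reg) proj₂ (λ _ → refl)

  justᶠ : ∀ {τ} → Fun Γ τ → Fun Γ (maybe τ)
  justᶠ = after (cons reg nil) just (λ _ → refl)

  infixr 4 _,ᶠ_
  _,ᶠ_ : ∀ {σ τ} → Fun Γ σ → Fun Γ τ → Fun Γ (σ ×ᵗ τ)
  (F ,ᶠ F′) .value γ = value F γ , value F′ γ
  (F ,ᶠ F′) .code = both (code F) (code F′)
  (F ,ᶠ F′) .correct γ = both-runs (correct F γ) (correct F′ γ)

  infixr 5 _∷ᶠ_
  _∷ᶠ_ : ∀ {τ} → Fun Γ τ → Fun Γ (list τ) → Fun Γ (list τ)
  (F ∷ᶠ F′) .value γ = value F γ ∷ value F′ γ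
  (F ∷ᶠ F′) .code = both (code F) (code F′)
  (F ∷ᶠ F′) .correct γ = both-runs (correct F γ) (correct F′ γ)

  private
    drop-runs : ∀ {r n d b v} .{{_ : NonZero n}} → Runs r n d v →
                Runs (eval (tl reg) then r) n (b ∙ d) v
    drop-runs R = eval-runs (tl reg) then-runs R

  cases : Fun Γ bool → Routine → Routine → Routine
  cases F r r′ = both (code F) (eval reg)
            then branch (eval (tl reg) then r) (eval (tl reg) then r′)

  cases-runs : ∀ (F : Fun Γ bool) {r r′ n v} .{{_ : NonZero n}} (γ : Env Γ n) →
               Runs (if value F γ then r else r′) n (encodeEnv Γ γ) v →
               Runs (cases F r r′) n (encodeEnv Γ γ) v
  cases-runs F {r} {r′} {n} {v} γ R =
    both-runs (correct F γ) (eval-runs reg) then-runs go (value F γ) R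
    where
    go : ∀ b → Runs (if b then r else r′) n (encodeEnv Γ γ) v →
         Runs (branch (eval (tl reg) then r) (eval (tl reg) then r′)) n
              (encodeBool b ∙ encodeEnv Γ γ) v
    go true  R = branch-∙ (drop-runs R)
    go false R = branch-nil (drop-runs R)

  infix 2 ifᶠ_then_else_
  ifᶠ_then_else_ : ∀ {τ} → Fun Γ bool → Fun Γ τ → Fun Γ τ → Fun Γ τ
  (ifᶠ F then F₁ else F₂) .value γ = if value F γ then value F₁ γ else value F₂ γ
  (ifᶠ F then F₁ else F₂) .code = cases F (code F₁) (code F₂)
  (ifᶠ_then_else_ {τ} F F₁ F₂) .correct {n} γ = cases-runs F γ (go (value F γ))
    where
    go : ∀ b → Runs (if b then code F₁ else code F₂) n (encodeEnv Γ γ)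
                    (encode τ (if b then value F₁ γ else value F₂ γ))
    go true  = correct F₁ γ
    go false = correct F₂ γ

  infixr 7 _∧ᶠ_
  infixr 6 _∨ᶠ_
  _∧ᶠ_ _∨ᶠ_ : Fun Γ bool → Fun Γ bool → Fun Γ bool
  F ∧ᶠ F′ = revalue (ifᶠ F then F′ else falseᶠ) (λ γ → value F γ ∧ value F′ γ)
                    (λ γ → if-∧ (value F γ))
    where
    if-∧ : ∀ a {b} → (if a then b else false) ≡ a ∧ b
    if-∧ true  = refl
    if-∧ false = refl
  F ∨ᶠ F′ = revalue (ifᶠ F then trueᶠ else F′) (λ γ → value F γ ∨ value F′ γ)
                    (λ γ → if-∨ (value F γ))
    where
    if-∨ : ∀ a {b} → (if a then true else b) ≡ a ∨ b
    if-∨ true  = refl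
    if-∨ false = refl

  notᶠ : Fun Γ bool → Fun Γ bool
  notᶠ F = revalue (ifᶠ F then falseᶠ else trueᶠ) (λ γ → not (value F γ))
                   (λ γ → if-not (value F γ))
    where
    if-not : ∀ a → (if a then false else true) ≡ not a
    if-not true  = refl
    if-not false = refl

  isZeroᶠ : Fun Γ nat → Fun Γ bool
  isZeroᶠ F .value γ = value F γ ≡ᵇ 0
  isZeroᶠ F .code = both (code F) (eval reg) then branch (eval nil) (eval (cons nil nil))
  isZeroᶠ F .correct γ = both-runs (correct F γ) (eval-runs reg) then-runs go (value F γ)
    where
    go : ∀ m → Runs (branch (eval nil) (eval (cons nil nil))) _ (unary m ∙ encodeEnv Γ γ)
                    (encodeBool (m ≡ᵇ 0))
    go zero    = branch-nil (eval-runs (cons nil nil))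
    go (suc m) = branch-∙ (eval-runs nil)

  maybeᶠ : ∀ {σ τ} → Fun (σ ∷ Γ) τ → Fun Γ τ → Fun Γ (maybe σ) → Fun Γ τ
  maybeᶠ J N F .value γ = maybe′ (λ x → value J (x , γ)) (value N γ) (value F γ)
  maybeᶠ J N F .code = both (code F) (eval reg)
    then branch (eval (cons (hd (hd reg)) (tl reg)) then code J) (eval (tl reg) then code N)
  maybeᶠ {σ} {τ} J N F .correct γ = both-runs (correct F γ) (eval-runs reg) then-runs go (value F γ)
    where
    go : ∀ m → Runs _ _ (encode (maybe σ) m ∙ encodeEnv Γ γ)
                    (encode τ (maybe′ (λ x → value J (x , γ)) (value N γ) m))
    go nothing  = branch-nil (drop-runs (correct N γ))
    go (just x) =
      branch-∙ (eval-runs (cons (hd (hd reg)) (tl reg)) then-runs correct J (x , γ))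

  foldᶠ : ∀ {σ} → Fun (vertex ∷ σ ∷ Γ) σ → Fun Γ σ → Fun Γ σ
  foldᶠ B F .value γ = fold (λ u s → value B (u , s , γ)) (value F γ)
  foldᶠ B F .code = both (eval (sizeExpr Γ reg)) (both (code F) (eval reg)) then repeat (code B)
  foldᶠ {σ} B F .correct γ =
    both-runs (size-runs Γ γ) (both-runs (correct F γ) (eval-runs reg))
      then-runs repeat-runs (encode σ) _ ≤-refl (λ u s → correct B (u , s , γ))

  fold-∙ : ∀ {m n} (f : Fin n → Tree) (g : Fin m → Fin n) →
           fold (λ u s → f (g u) ∙ s) nil ≡ encodeList (map f (tabulate g))
  fold-∙ {zero}  f g = refl
  fold-∙ {suc m} f g = cong (f (g zero) ∙_) (fold-∙ f (λ u → g (suc u)))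

  tabulateᶠ : ∀ {τ} → Fun (vertex ∷ Γ) τ → Fun Γ (table τ)
  tabulateᶠ B .value γ u = value B (u , γ)
  tabulateᶠ B .code = both (eval (sizeExpr Γ reg)) (both (eval nil) (eval reg))
    then repeat (both (eval (cons (hd reg) (tl (tl reg))) then code B) (eval (hd (tl reg))))
  tabulateᶠ {τ} B .correct {n} γ =
    both-runs (size-runs Γ γ) (both-runs (eval-runs nil) (eval-runs reg))
      then-runs subst (Runs _ _ _) (fold-∙ (λ u → encode τ (value B (u , γ))) (λ u → u))
        (repeat-runs (λ t → t) (λ u s → encode τ (value B (u , γ)) ∙ s) ≤-refl
          (λ u s → both-runs
             (eval-runs (cons (hd reg) (tl (tl reg))) then-runs correct B (u , γ))
             (eval-runs (hd (tl reg)))))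

  -- Dropping m cells serves two purposes: on a coded list it leads to the entry with index m, and
  -- on a unary numeral it is truncated subtraction, from which equality of vertices is decided.
  advance : Routine
  advance = repeat (eval (tl (hd (tl reg))))

  advance-runs : ∀ {n d m t} .{{_ : NonZero n}} → m ≤ n →
                 Runs advance n (unary m ∙ (t ∙ d)) (fold {m = m} (λ _ → tail) t)
  advance-runs m≤n = repeat-runs (λ t → t) (λ _ → tail) m≤n (λ _ _ → eval-runs (tl (hd (tl reg))))

  fold-tail : ∀ {m} t → fold {m = suc m} (λ _ → tail) t ≡ fold {m = m} (λ _ → tail) (tail t)
  fold-tail {zero}  t = refl
  fold-tail {suc m} t = cong tail (fold-tail {m} t)

  nth : ∀ {n} (f : Fin n → Tree) {m} (g : Fin m → Fin n) (u : Fin m) →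
        head (fold {m = toℕ u} (λ _ → tail) (encodeList (map f (tabulate g)))) ≡ f (g u)
  nth f g zero    = refl
  nth f g (suc u) = trans (cong head (fold-tail {toℕ u} _)) (nth f (λ i → g (suc i)) u)

  infixl 9 _at_
  _at_ : ∀ {τ} → Fun Γ (table τ) → Fun Γ vertex → Fun Γ τ
  (F at U) .value γ = value F γ (value U γ)
  (F at U) .code = both (code U) (both (code F) (eval reg)) then advance then eval (hd reg)
  (_at_ {τ} F U) .correct γ =
    both-runs (correct U γ) (both-runs (correct F γ) (eval-runs reg))
      then-runs advance-runs (toℕ≤n (value U γ))
      then-runs subst (Runs _ _ _) (nth (λ u → encode τ (value F γ u)) (λ u → u) (value U γ))
                      (eval-runs (hd reg))

  fold-tail-unary : ∀ m b → fold {m = m} (λ _ → tail) (unary b) ≡ unary (b ∸ m)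
  fold-tail-unary zero    b       = refl
  fold-tail-unary (suc m) zero    =
    trans (fold-tail {m} nil) (trans (fold-tail-unary m zero) (cong unary (0∸n≡0 m)))
  fold-tail-unary (suc m) (suc b) = trans (fold-tail {m} _) (fold-tail-unary m b)

  _∸ᶠ_ : Fun Γ vertex → Fun Γ vertex → Fun Γ nat
  (V ∸ᶠ U) .value γ = toℕ (value V γ) ∸ toℕ (value U γ)
  (V ∸ᶠ U) .code = both (code U) (both (code V) (eval reg)) then advance
  (V ∸ᶠ U) .correct γ =
    both-runs (correct U γ) (both-runs (correct V γ) (eval-runs reg))
      then-runs subst (Runs _ _ _) (fold-tail-unary (toℕ (value U γ)) (toℕ (value V γ)))
                      (advance-runs (toℕ≤n (value U γ)))

  infix 8 _≟ᶠ_
  _≟ᶠ_ : Fun Γ vertex → Fun Γ vertex → Fun Γ bool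
  U ≟ᶠ V = revalue (isZeroᶠ (V ∸ᶠ U) ∧ᶠ isZeroᶠ (U ∸ᶠ V))
                   (λ γ → ⌊ value U γ ≟ value V γ ⌋) (λ γ → agree (value U γ) (value V γ))
    where
    agree : ∀ {n} (u v : Fin n) →
            (toℕ v ∸ toℕ u ≡ᵇ 0) ∧ (toℕ u ∸ toℕ v ≡ᵇ 0) ≡ ⌊ u ≟ v ⌋
    agree u v with u ≟ v
    ... | yes refl rewrite n∸n≡0 (toℕ u) = refl
    ... | no u≢v with toℕ v ∸ toℕ u in p | toℕ u ∸ toℕ v in q
    ...   | suc _ | _     = refl
    ...   | zero  | suc _ = refl
    ...   | zero  | zero  =
      contradiction (toℕ-injective (≤-antisym (m∸n≡0⇒m≤n q) (m∸n≡0⇒m≤n p))) u≢v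

-- Spanning forests

Sub : ℕ → Set
Sub n = Fin n → Bool

Matrix : ℕ → Set
Matrix n = Fin n → Fin n → Bool

⟨_⟩ : ∀ {n} → Matrix n → Rel (Fin n) 0ℓ
⟨ M ⟩ x y = T (M x y)

∧⁺ : ∀ {a b} → T a → T b → T (a ∧ b)
∧⁺ p q = Equivalence.from T-∧ (p , q)

∧⁻ : ∀ {a b} → T (a ∧ b) → T a × T b
∧⁻ = Equivalence.to T-∧

∨⁺ : ∀ {a b} → T a ⊎ T b → T (a ∨ b)
∨⁺ = Equivalence.from T-∨

∨⁻ : ∀ {a b} → T (a ∨ b) → T a ⊎ T b
∨⁻ = Equivalence.to T-∨

not⁺ : ∀ {a} → ¬ T a → T (not a)
not⁺ {true}  p = p _
not⁺ {false} _ = _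

not⁻ : ∀ {a} → T (not a) → ¬ T a
not⁻ {false} _ ()

if⁻ : ∀ {S : Set} (P : S → Set) b {x y} → (T b → P x) → (¬ T b → P y) → P (if b then x else y)
if⁻ P true  p q = p _
if⁻ P false p q = q id

∨⁺₃ : ∀ {a b c} → T a ⊎ T b ⊎ T c → T (a ∨ b ∨ c)
∨⁺₃ (inj₁ p) = ∨⁺ (inj₁ p)
∨⁺₃ {a} (inj₂ q) = ∨⁺ {a} (inj₂ (∨⁺ q))

∨⁻₃ : ∀ {a b c} → T (a ∨ b ∨ c) → T a ⊎ T b ⊎ T c
∨⁻₃ {a} p with ∨⁻ {a} p
... | inj₁ q = inj₁ q
... | inj₂ q = inj₂ (∨⁻ q)

module _ {S : Set} (P : S → Set) where

  fold-preserves : ∀ {m} (f : Fin m → S → S) → (∀ i s → P s → P (f i s)) →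
                   ∀ s → P s → P (fold f s)
  fold-preserves {zero}  f step s p = p
  fold-preserves {suc m} f step s p =
    step zero _ (fold-preserves (f ∘ suc) (step ∘ suc) s p)

  fold-reaches : ∀ {m} (f : Fin m → S → S) (Q : Fin m → S → Set) →
    (∀ i s → P s → P (f i s)) → (∀ i s → P s → Q i (f i s)) →
    (∀ i j s → P s → Q j s → Q j (f i s)) →
    ∀ s → P s → ∀ i → Q i (fold f s)
  fold-reaches f Q step hit keep s p zero =
    hit zero _ (fold-preserves (f ∘ suc) (step ∘ suc) s p)
  fold-reaches f Q step hit keep s p (suc i) =
    keep zero (suc i) _ (fold-preserves (f ∘ suc) (step ∘ suc) s p)
      (fold-reaches (f ∘ suc) (Q ∘ suc) (step ∘ suc) (hit ∘ suc)
         (λ j k → keep (suc j) (suc k)) s p i)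

fold-counts : ∀ {S : Set} (P : ℕ → S → Set) {m} (f : Fin m → S → S) →
              (∀ i l s → P l s → P (suc l) (f i s)) → ∀ s → P 0 s → P m (fold f s)
fold-counts P {zero}  f step s p = p
fold-counts P {suc m} f step s p = step zero m _ (fold-counts P (f ∘ suc) (step ∘ suc) s p)

open IsEquivalence renaming (refl to reflx; sym to symm; trans to transi)

star-least : ∀ {A : Set} {S E : Rel A 0ℓ} → IsEquivalence E → (∀ {x y} → S x y → E x y) →
             ∀ {x y} → Star S x y → E x y
star-least eq S⊆E = star-fold _ (transi eq ∘ S⊆E) (reflx eq)

star-isEquiv : ∀ {A : Set} {S : Rel A 0ℓ} → (∀ {x y} → S x y → S y x) → IsEquivalence (Star S)
star-isEquiv sym .reflx = ε
star-isEquiv sym .symm = reverse sym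
star-isEquiv sym .transi = _◅◅_

Ends : ∀ {A : Set} → A → A → Rel A 0ℓ
Ends a b x y = (x ≡ a × y ≡ b) ⊎ (x ≡ b × y ≡ a)

Ends-sym : ∀ {A : Set} {a b x y : A} → Ends a b x y → Ends a b y x
Ends-sym (inj₁ (p , q)) = inj₂ (q , p)
Ends-sym (inj₂ (p , q)) = inj₁ (q , p)

Ends-flip : ∀ {A : Set} {a b x y : A} → Ends a b x y → Ends b a x y
Ends-flip (inj₁ p) = inj₂ p
Ends-flip (inj₂ p) = inj₁ p

-- For an equivalence `E` this is the equivalence generated by `E` and the pair of `a` and `b`: the
-- new pair is needed at most once, in one of its two directions.
Link : ∀ {A : Set} → A → A → Rel A 0ℓ → Rel A 0ℓ
Link a b E x y = E x y ⊎ (E x a × E b y) ⊎ (E x b × E a y)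

Link-isEquiv : ∀ {A : Set} (a b : A) {E : Rel A 0ℓ} → IsEquivalence E → IsEquivalence (Link a b E)
Link-isEquiv a b eq .reflx = inj₁ (reflx eq)
Link-isEquiv a b eq .symm (inj₁ p) = inj₁ (symm eq p)
Link-isEquiv a b eq .symm (inj₂ (inj₁ (p , q))) = inj₂ (inj₂ (symm eq q , symm eq p))
Link-isEquiv a b eq .symm (inj₂ (inj₂ (p , q))) = inj₂ (inj₁ (symm eq q , symm eq p))
Link-isEquiv a b eq .transi (inj₁ p) (inj₁ q) = inj₁ (transi eq p q)
Link-isEquiv a b eq .transi (inj₁ p) (inj₂ (inj₁ (q , r))) = inj₂ (inj₁ (transi eq p q , r))
Link-isEquiv a b eq .transi (inj₁ p) (inj₂ (inj₂ (q , r))) = inj₂ (inj₂ (transi eq p q , r))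
Link-isEquiv a b eq .transi (inj₂ (inj₁ (p , q))) (inj₁ r) = inj₂ (inj₁ (p , transi eq q r))
Link-isEquiv a b eq .transi (inj₂ (inj₂ (p , q))) (inj₁ r) = inj₂ (inj₂ (p , transi eq q r))
Link-isEquiv a b eq .transi (inj₂ (inj₁ (p , q))) (inj₂ (inj₁ (r , s))) = inj₂ (inj₁ (p , s))
Link-isEquiv a b eq .transi (inj₂ (inj₁ (p , q))) (inj₂ (inj₂ (r , s))) = inj₁ (transi eq p s)
Link-isEquiv a b eq .transi (inj₂ (inj₂ (p , q))) (inj₂ (inj₁ (r , s))) = inj₁ (transi eq p s)
Link-isEquiv a b eq .transi (inj₂ (inj₂ (p , q))) (inj₂ (inj₂ (r , s))) = inj₂ (inj₂ (p , s))

equal : ∀ {n} → Matrix n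
equal x y = ⌊ x ≟ y ⌋

link : ∀ {n} → Fin n → Fin n → Matrix n → Matrix n
link a b R x y = R x y ∨ R x a ∧ R b y ∨ R x b ∧ R a y

insert : ∀ {n} → Fin n → Fin n → Matrix n → Matrix n
insert a b F x y = F x y ∨ equal x a ∧ equal y b ∨ equal x b ∧ equal y a

module _ {n} {a b : Fin n} {R : Matrix n} where

  link⁻ : ∀ {x y} → T (link a b R x y) → Link a b ⟨ R ⟩ x y
  link⁻ {x} {y} p with ∨⁻₃ {R x y} {R x a ∧ R b y} p
  ... | inj₁ q        = inj₁ q
  ... | inj₂ (inj₁ q) = inj₂ (inj₁ (∧⁻ q))
  ... | inj₂ (inj₂ q) = inj₂ (inj₂ (∧⁻ q))

  link⁺ : ∀ {x y} → Link a b ⟨ R ⟩ x y → T (link a b R x y)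
  link⁺ {x} {y} (inj₁ p) = ∨⁺₃ {R x y} {R x a ∧ R b y} (inj₁ p)
  link⁺ {x} {y} (inj₂ (inj₁ (p , q))) = ∨⁺₃ {R x y} {R x a ∧ R b y} (inj₂ (inj₁ (∧⁺ p q)))
  link⁺ {x} {y} (inj₂ (inj₂ (p , q))) = ∨⁺₃ {R x y} {R x a ∧ R b y} (inj₂ (inj₂ (∧⁺ p q)))

  insert⁻ : ∀ {x y} → T (insert a b R x y) → T (R x y) ⊎ Ends a b x y
  insert⁻ {x} {y} p with ∨⁻₃ {R x y} {equal x a ∧ equal y b} p
  ... | inj₁ q = inj₁ q
  ... | inj₂ (inj₁ q) = let e , f = ∧⁻ {equal x a} q in inj₂ (inj₁ (toWitness e , toWitness f))
  ... | inj₂ (inj₂ q) = let e , f = ∧⁻ {equal x b} q in inj₂ (inj₂ (toWitness e , toWitness f))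

  insert⁺ : ∀ {x y} → T (R x y) ⊎ Ends a b x y → T (insert a b R x y)
  insert⁺ {x} {y} (inj₁ p) = ∨⁺₃ {R x y} {equal x a ∧ equal y b} (inj₁ p)
  insert⁺ {x} {y} (inj₂ (inj₁ (p , q))) = ∨⁺₃ {R x y} {equal x a ∧ equal y b}
    (inj₂ (inj₁ (∧⁺ (fromWitness {a? = x ≟ a} p) (fromWitness {a? = y ≟ b} q))))
  insert⁺ {x} {y} (inj₂ (inj₂ (p , q))) = ∨⁺₃ {R x y} {equal x a ∧ equal y b}
    (inj₂ (inj₂ (∧⁺ (fromWitness {a? = x ≟ b} p) (fromWitness {a? = y ≟ a} q))))

link-isEquiv : ∀ {n} (a b : Fin n) {R} → IsEquivalence ⟨ R ⟩ → IsEquivalence ⟨ link a b R ⟩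
link-isEquiv a b {R} eq .reflx = link⁺ {R = R} (reflx (Link-isEquiv a b eq))
link-isEquiv a b {R} eq .symm p = link⁺ {R = R} (symm (Link-isEquiv a b eq) (link⁻ {R = R} p))
link-isEquiv a b {R} eq .transi p q =
  link⁺ {R = R} (transi (Link-isEquiv a b eq) (link⁻ {R = R} p) (link⁻ {R = R} q))

Without : ∀ {A : Set} → Rel A 0ℓ → A → A → Rel A 0ℓ
Without S a b x y = S x y × ¬ Ends a b x y

-- A forest together with its connectivity relation, the state of Kruskal's
-- algorithm.
record IsForest {n} (F R : Matrix n) : Set where
  field
    F-sym   : ∀ {x y} → ⟨ F ⟩ x y → ⟨ F ⟩ y x
    R-equiv : IsEquivalence ⟨ R ⟩
    F⊆R     : ∀ {x y} → ⟨ F ⟩ x y → ⟨ R ⟩ x y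
    R⊆F*    : ∀ {x y} → ⟨ R ⟩ x y → Star ⟨ F ⟩ x y
    bridge  : ∀ {x y} → ⟨ F ⟩ x y → ¬ Star (Without ⟨ F ⟩ x y) x y

  F-irrefl : ∀ {x} → ¬ ⟨ F ⟩ x x
  F-irrefl p = bridge p ε

  F*⊆R : ∀ {x y} → Star ⟨ F ⟩ x y → ⟨ R ⟩ x y
  F*⊆R = star-least R-equiv F⊆R

open IsForest

empty-isForest : ∀ {n} → IsForest {n} (λ _ _ → false) equal
empty-isForest .F-sym ()
empty-isForest .R-equiv .reflx {x} = fromWitness {a? = x ≟ x} refl
empty-isForest .R-equiv .symm {x} {y} p = fromWitness {a? = y ≟ x} (sym (toWitness p))
empty-isForest .R-equiv .transi {x} {y} {z} p q =
  fromWitness {a? = x ≟ z} (trans (toWitness p) (toWitness q))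
empty-isForest .F⊆R ()
empty-isForest .R⊆F* {x} {y} p with x ≟ y
... | yes refl = ε
empty-isForest .bridge ()

-- A detour around the new edge would lie in `F` and put `a` and `b` in one class of `R`. A detour
-- around an old edge either avoids the new edge or, closed up by the old edge, again connects `a`
-- to `b` in `R`.
insert-isForest : ∀ {n} {F R : Matrix n} {a b} → IsForest F R → ¬ ⟨ R ⟩ a b →
                  IsForest (insert a b F) (link a b R)
insert-isForest {F = F} {R} {a} {b} φ ¬ab = λ where
    .F-sym {x} {y} p → insert⁺ {R = F} (flip (insert⁻ {R = F} p))
    .R-equiv → R′-equiv
    .F⊆R p → F′⊆R′ (insert⁻ {R = F} p)
    .R⊆F* p → R′⊆F′* (link⁻ {R = R} p)
    .bridge p → bridge′ (insert⁻ {R = F} p)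
  where
  R′-equiv = link-isEquiv a b {R} (R-equiv φ)

  flip : ∀ {x y} → ⟨ F ⟩ x y ⊎ Ends a b x y → ⟨ F ⟩ y x ⊎ Ends a b y x
  flip (inj₁ p) = inj₁ (F-sym φ p)
  flip (inj₂ p) = inj₂ (Ends-sym p)

  F′⊆R′ : ∀ {x y} → ⟨ F ⟩ x y ⊎ Ends a b x y → ⟨ link a b R ⟩ x y
  F′⊆R′ (inj₁ p) = link⁺ {R = R} (inj₁ (F⊆R φ p))
  F′⊆R′ (inj₂ (inj₁ (refl , refl))) =
    link⁺ {R = R} (inj₂ (inj₁ (reflx (R-equiv φ) , reflx (R-equiv φ))))
  F′⊆R′ (inj₂ (inj₂ (refl , refl))) =
    link⁺ {R = R} (inj₂ (inj₂ (reflx (R-equiv φ) , reflx (R-equiv φ))))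

  old : ∀ {x y} → ⟨ R ⟩ x y → Star ⟨ insert a b F ⟩ x y
  old p = gmap id (insert⁺ {R = F} ∘ inj₁) (R⊆F* φ p)

  R′⊆F′* : ∀ {x y} → Link a b ⟨ R ⟩ x y → Star ⟨ insert a b F ⟩ x y
  R′⊆F′* (inj₁ p) = old p
  R′⊆F′* (inj₂ (inj₁ (p , q))) =
    old p ◅◅ insert⁺ {R = F} (inj₂ (inj₁ (refl , refl))) ◅ old q
  R′⊆F′* (inj₂ (inj₂ (p , q))) =
    old p ◅◅ insert⁺ {R = F} (inj₂ (inj₂ (refl , refl))) ◅ old q

  drop-new : ∀ {x y u v} → Ends a b x y → Without ⟨ insert a b F ⟩ x y u v → ⟨ F ⟩ u v
  drop-new ab (p , ¬uv) with insert⁻ {R = F} p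
  ... | inj₁ q = q
  drop-new (inj₁ (refl , refl)) (p , ¬uv) | inj₂ q = contradiction q ¬uv
  drop-new (inj₂ (refl , refl)) (p , ¬uv) | inj₂ q = contradiction (Ends-flip q) ¬uv

  Link-Without : ∀ {x y u v} → Without ⟨ insert a b F ⟩ x y u v →
                 Link a b (Star (Without ⟨ F ⟩ x y)) u v
  Link-Without (p , ¬uv) with insert⁻ {R = F} p
  ... | inj₁ q = inj₁ ((q , ¬uv) ◅ ε)
  ... | inj₂ (inj₁ (refl , refl)) = inj₂ (inj₁ (ε , ε))
  ... | inj₂ (inj₂ (refl , refl)) = inj₂ (inj₂ (ε , ε))

  within-R : ∀ {x y u v} → Star (Without ⟨ F ⟩ x y) u v → ⟨ R ⟩ u v
  within-R = F*⊆R φ ∘ gmap id proj₁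

  bridge′ : ∀ {x y} → ⟨ F ⟩ x y ⊎ Ends a b x y → ¬ Star (Without ⟨ insert a b F ⟩ x y) x y
  bridge′ {x} {y} (inj₂ ab) w = ¬ab (ends ab (F*⊆R φ (gmap id (drop-new ab) w)))
    where
    ends : ∀ {x y} → Ends a b x y → ⟨ R ⟩ x y → ⟨ R ⟩ a b
    ends (inj₁ (refl , refl)) p = p
    ends (inj₂ (refl , refl)) p = symm (R-equiv φ) p
  -- Folding the detour into `Link` leaves at most one passage through the new edge, with
  -- connections in `F` without the edge from `x` to `y` on both sides of it.
  bridge′ {x} {y} (inj₁ xy) w with
    star-least (Link-isEquiv a b (star-isEquiv (λ { (p , ¬uv) → F-sym φ p , ¬uv ∘ Ends-sym })))
               Link-Without w
  ... | inj₁ p = bridge φ xy p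
  ... | inj₂ (inj₁ (p , q)) =
    ¬ab (transi (R-equiv φ) (symm (R-equiv φ) (within-R p))
          (transi (R-equiv φ) (F⊆R φ xy) (symm (R-equiv φ) (within-R q))))
  ... | inj₂ (inj₂ (p , q)) =
    ¬ab (transi (R-equiv φ) (within-R q)
          (transi (R-equiv φ) (symm (R-equiv φ) (F⊆R φ xy)) (within-R p)))

State : ℕ → Set
State n = Matrix n × Matrix n

add : ∀ {n} → Matrix n → Fin n → Fin n → State n → State n
add E u v (F , R) = if E u v ∧ not (R u v) then (insert u v F , link u v R) else (F , R)

-- One greedy pass over all pairs has three uses: from `start` it computes the components, with the
-- frontier edges it adds a layer to a breadth-first forest, and with all edges of a connected graph
-- it completes a forest to a spanning tree.
grow : ∀ {n} → Matrix n → State n → State n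
grow E s = fold (λ u s → fold (λ v s → add E u v s) s) s

start : ∀ {n} → State n
start = (λ _ _ → false) , equal

components : ∀ {n} → Matrix n → Matrix n
components E = proj₂ (grow E start)

record Grows {n} (E : Matrix n) (s s′ : State n) : Set where
  field
    forest : IsForest (proj₁ s′) (proj₂ s′)
    F-mono : ∀ {x y} → ⟨ proj₁ s ⟩ x y → ⟨ proj₁ s′ ⟩ x y
    R-mono : ∀ {x y} → ⟨ proj₂ s ⟩ x y → ⟨ proj₂ s′ ⟩ x y
    F-new  : ∀ {x y} → ⟨ proj₁ s′ ⟩ x y → ⟨ proj₁ s ⟩ x y ⊎ ⟨ E ⟩ x y ⊎ ⟨ E ⟩ y x

open Grows

module _ {n} (E : Matrix n) where

  add-spec : ∀ {s₀ s} u v → Grows E s₀ s →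
             Grows E s₀ (add E u v s) × (⟨ E ⟩ u v → ⟨ proj₂ (add E u v s) ⟩ u v) ×
             (∀ {x y} → ⟨ proj₂ s ⟩ x y → ⟨ proj₂ (add E u v s) ⟩ x y)
  add-spec {s₀} {s@(F , R)} u v g = if⁻
    (λ s′ → Grows E s₀ s′ × (⟨ E ⟩ u v → ⟨ proj₂ s′ ⟩ u v) ×
            (∀ {x y} → ⟨ proj₂ s ⟩ x y → ⟨ proj₂ s′ ⟩ x y))
    (E u v ∧ not (R u v)) new old
    where
    R-eq = R-equiv (forest g)
    mono : ∀ {x y} → ⟨ R ⟩ x y → ⟨ link u v R ⟩ x y
    mono p = link⁺ {R = R} (inj₁ p)
    new : T (E u v ∧ not (R u v)) → Grows E s₀ (insert u v F , link u v R) ×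
          (⟨ E ⟩ u v → ⟨ link u v R ⟩ u v) × (∀ {x y} → ⟨ R ⟩ x y → ⟨ link u v R ⟩ x y)
    new p with ∧⁻ {E u v} p
    ... | uv , ¬R = record
      { forest = insert-isForest (forest g) (not⁻ {R u v} ¬R)
      ; F-mono = λ q → insert⁺ {R = F} (inj₁ (F-mono g q))
      ; R-mono = λ q → mono (R-mono g q)
      ; F-new  = λ q → origin (insert⁻ {R = F} q)
      } , (λ _ → link⁺ {R = R} (inj₂ (inj₁ (reflx R-eq , reflx R-eq)))) , mono
      where
      origin : ∀ {x y} → ⟨ F ⟩ x y ⊎ Ends u v x y → ⟨ proj₁ s₀ ⟩ x y ⊎ ⟨ E ⟩ x y ⊎ ⟨ E ⟩ y x
      origin (inj₁ q) = F-new g q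
      origin (inj₂ (inj₁ (refl , refl))) = inj₂ (inj₁ uv)
      origin (inj₂ (inj₂ (refl , refl))) = inj₂ (inj₂ uv)
    old : ¬ T (E u v ∧ not (R u v)) → Grows E s₀ s × (⟨ E ⟩ u v → ⟨ R ⟩ u v) ×
          (∀ {x y} → ⟨ R ⟩ x y → ⟨ R ⟩ x y)
    old ¬p = g , joined , id
      where
      joined : ⟨ E ⟩ u v → ⟨ R ⟩ u v
      joined uv with R u v
      ... | true  = _
      ... | false = contradiction (∧⁺ uv _) ¬p

  module _ (s₀ : State n) (φ : IsForest (proj₁ s₀) (proj₂ s₀)) where

    private
      start-grows : Grows E s₀ s₀
      start-grows = record { forest = φ ; F-mono = id ; R-mono = id ; F-new = inj₁ }

      row : Fin n → State n → State n
      row u s = fold (λ v s → add E u v s) s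

      row-grows : ∀ u s → Grows E s₀ s → Grows E s₀ (row u s)
      row-grows u = fold-preserves (Grows E s₀) _ (λ v s g → proj₁ (add-spec u v g))

      row-keeps : ∀ u {x y} s → Grows E s₀ s → ⟨ proj₂ s ⟩ x y → ⟨ proj₂ (row u s) ⟩ x y
      row-keeps u {x} {y} s g p = proj₂ (fold-preserves (λ s → Grows E s₀ s × ⟨ proj₂ s ⟩ x y) _
        (λ { v s (g , p) → let g′ , _ , m = add-spec u v g in g′ , m p }) s (g , p))

      row-joins : ∀ u s → Grows E s₀ s → ∀ v → ⟨ E ⟩ u v → ⟨ proj₂ (row u s) ⟩ u v
      row-joins u s g = fold-reaches (Grows E s₀) _ (λ v s → ⟨ E ⟩ u v → ⟨ proj₂ s ⟩ u v)
        (λ v s g → proj₁ (add-spec u v g)) (λ v s g → proj₁ (proj₂ (add-spec u v g)))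
        (λ v w s g p e → proj₂ (proj₂ (add-spec u v g)) (p e)) s g

    grow-grows : Grows E s₀ (grow E s₀)
    grow-grows = fold-preserves (Grows E s₀) row row-grows s₀ start-grows

    grow-joins : ∀ {u v} → ⟨ E ⟩ u v → ⟨ proj₂ (grow E s₀) ⟩ u v
    grow-joins {u} {v} = fold-reaches (Grows E s₀) row
      (λ u s → ∀ v → ⟨ E ⟩ u v → ⟨ proj₂ s ⟩ u v) row-grows row-joins
      (λ u w s g p v e → row-keeps u s g (p v e)) s₀ start-grows u v

    grow-joins* : ∀ {u v} → Star ⟨ E ⟩ u v → ⟨ proj₂ (grow E s₀) ⟩ u v
    grow-joins* = star-least (R-equiv (forest grow-grows)) grow-joins

  components-isEquiv : IsEquivalence ⟨ components E ⟩
  components-isEquiv = R-equiv (forest (grow-grows start empty-isForest))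

  components-complete : ∀ {u v} → Star ⟨ E ⟩ u v → ⟨ components E ⟩ u v
  components-complete = grow-joins* start empty-isForest

  components-sound : (∀ {x y} → ⟨ E ⟩ x y → ⟨ E ⟩ y x) →
                     ∀ {u v} → ⟨ components E ⟩ u v → Star ⟨ E ⟩ u v
  components-sound E-sym p = gmap id edge (R⊆F* (forest g) p)
    where
    g = grow-grows start empty-isForest
    edge : ∀ {x y} → ⟨ proj₁ (grow E start) ⟩ x y → ⟨ E ⟩ x y
    edge q with F-new g q
    ... | inj₂ (inj₁ e) = e
    ... | inj₂ (inj₂ e) = E-sym e

-- Walks and breadth-first search

module _ {A : Set} where

  star⇒walk : ∀ {R : Rel A 0ℓ} {x y} → Star R x y → ∃ (Walk R x y)
  star⇒walk ε       = 0 , []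
  star⇒walk (p ◅ w) = _ , p ∷ proj₂ (star⇒walk w)

  walk⇒star : ∀ {R : Rel A 0ℓ} {x y ℓ} → Walk R x y ℓ → Star R x y
  walk⇒star []      = ε
  walk⇒star (p ∷ w) = p ◅ walk⇒star w

  walk-map : ∀ {R S : Rel A 0ℓ} → (∀ {x y} → R x y → S x y) →
             ∀ {x y ℓ} → Walk R x y ℓ → Walk S x y ℓ
  walk-map f []      = []
  walk-map f (p ∷ w) = f p ∷ walk-map f w

  vertices-map : ∀ {R S : Rel A 0ℓ} (f : ∀ {x y} → R x y → S x y) {x y ℓ}
                 (w : Walk R x y ℓ) → vertices (walk-map f w) ≡ vertices w
  vertices-map f []      = refl
  vertices-map f (p ∷ w) = cong (_ ∷_) (vertices-map f w)

  infixr 5 _++ʷ_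
  _++ʷ_ : ∀ {R : Rel A 0ℓ} {x y z ℓ m} → Walk R x y ℓ → Walk R y z m → Walk R x z (ℓ + m)
  []      ++ʷ v = v
  (p ∷ w) ++ʷ v = p ∷ (w ++ʷ v)

  walk-reverse : ∀ {R : Rel A 0ℓ} → (∀ {x y} → R x y → R y x) →
                 ∀ {x y ℓ} → Walk R x y ℓ → Walk R y x ℓ
  walk-reverse sym []                = []
  walk-reverse {R} sym {x} {y} (_∷_ {ℓ = ℓ} p w) =
    subst (Walk R y x) (+-comm ℓ 1) (walk-reverse sym w ++ʷ (sym p ∷ []))

  first∈ : ∀ {R : Rel A 0ℓ} {x y ℓ} (w : Walk R x y ℓ) → x ∈ vertices w
  first∈ []      = here refl
  first∈ (p ∷ w) = here refl

  last∈ : ∀ {R : Rel A 0ℓ} {x y ℓ} (w : Walk R x y ℓ) → y ∈ vertices w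
  last∈ []      = here refl
  last∈ (p ∷ w) = there (last∈ w)

  length-vertices : ∀ {R : Rel A 0ℓ} {x y ℓ} (w : Walk R x y ℓ) → length (vertices w) ≡ suc ℓ
  length-vertices []      = refl
  length-vertices (p ∷ w) = cong suc (length-vertices w)

Path : ∀ {A : Set} → Rel A 0ℓ → A → A → ℕ → Set
Path R x y ℓ = ∃ λ (w : Walk R x y ℓ) → Unique (vertices w)

path-suffix : ∀ {A : Set} {R : Rel A 0ℓ} {x y z : A} {ℓ} (w : Walk R x y ℓ) →
              Unique (vertices w) → z ∈ vertices w → ∃ λ m → m ≤ ℓ × Path R z y m
path-suffix []      u       (here refl) = 0 , z≤n , [] , u
path-suffix (p ∷ w) u       (here refl) = _ , ≤-refl , p ∷ w , u
path-suffix (p ∷ w) (_ ∷ u) (there z∈)  =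
  let m , m≤ , q = path-suffix w u z∈ in m , m≤n⇒m≤1+n m≤ , q

walk⇒path : ∀ {n} {R : Rel (Fin n) 0ℓ} {x y ℓ} → Walk R x y ℓ → ∃ λ m → m ≤ ℓ × Path R x y m
walk⇒path [] = 0 , z≤n , [] , [] ∷ []
walk⇒path {x = x} (p ∷ w) with walk⇒path w
... | m , m≤ , v , u with _∈?_ _≟_ x (vertices v)
...   | yes x∈ = let k , k≤ , q = path-suffix v u x∈ in k , ≤-trans k≤ (m≤n⇒m≤1+n m≤) , q
...   | no  x∉ = suc m , s≤s m≤ , p ∷ v , ¬Any⇒All¬ _ x∉ ∷ u

lookup-injective : ∀ {A : Set} {xs : List A} → Unique xs →
                   ∀ {i j} → lookup xs i ≡ lookup xs j → i ≡ j
lookup-injective (x∉ ∷ u) {zero}  {zero}  eq = refl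
lookup-injective {xs = _ ∷ xs} (x∉ ∷ u) {zero} {suc j} eq =
  contradiction eq (All.lookup x∉ (∈-lookup {xs = xs} j))
lookup-injective {xs = _ ∷ xs} (x∉ ∷ u) {suc i} {zero} eq =
  contradiction (sym eq) (All.lookup x∉ (∈-lookup {xs = xs} i))
lookup-injective (x∉ ∷ u) {suc i} {suc j} eq = cong suc (lookup-injective u eq)

path-length< : ∀ {n} {R : Rel (Fin n) 0ℓ} {x y ℓ} → Path R x y ℓ → ℓ < n
path-length< {n} (w , u) =
  subst (_≤ n) (length-vertices w) (injective⇒≤ (lookup-injective u))

shorten : ∀ {n} {R : Rel (Fin n) 0ℓ} {x y ℓ} → Walk R x y ℓ → ∃ λ m → m ≤ ℓ × m < n × Walk R x y m
shorten w = let m , m≤ , p = walk⇒path w in m , m≤ , path-length< p , proj₁ p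

avoids : ∀ {A : Set} {R : Rel A 0ℓ} {x y z t : A} {ℓ} (w : Walk R x y ℓ) →
         z ∉ vertices w → Star (Without R z t) x y
avoids [] z∉ = ε
avoids {z = z} (_∷_ {u = a} {v = b} p w) z∉ = (p , not-ends) ◅ avoids w (z∉ ∘ there)
  where
  not-ends : ¬ Ends z _ a b
  not-ends (inj₁ (refl , _)) = z∉ (here refl)
  not-ends (inj₂ (_ , refl)) = z∉ (there (first∈ w))

-- The first step ends in an inner vertex and `x` is never visited again, so no step joins the two
-- ends. This turns a cycle into a detour around its closing edge, contradicting that the edge is a
-- bridge.
path-avoids : ∀ {A : Set} {R : Rel A 0ℓ} {x y : A} {ℓ} (w : Walk R x y ℓ) →
              Unique (vertices w) → 2 ≤ ℓ → Star (Without R x y) x y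
path-avoids {x = x} {y} (_∷_ {v = b} p w) u (s≤s 1≤ℓ) =
  (p , not-ends w u 1≤ℓ) ◅ avoids w (Unique[x∷xs]⇒x∉xs u)
  where
  not-ends : ∀ {ℓ} (w : Walk _ b y ℓ) → Unique (x ∷ vertices w) → 1 ≤ ℓ → ¬ Ends x y x b
  not-ends (_ ∷ w) (_ ∷ u) _ (inj₁ (_ , refl)) = Unique[x∷xs]⇒x∉xs u (last∈ w)
  not-ends w u _ (inj₂ (_ , refl)) = Unique[x∷xs]⇒x∉xs u (first∈ w)

T-ext : ∀ {a b} → (T a → T b) → (T b → T a) → a ≡ b
T-ext {true}  {true}  _ _ = refl
T-ext {false} {false} _ _ = refl
T-ext {true}  {false} f _ = contradiction _ f
T-ext {false} {true}  _ g = contradiction _ g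

module _ {n} {F R : Matrix n} (φ : IsForest F R) (n≢0 : NonZero n)
         (total : ∀ x y → ⟨ R ⟩ x y) where

  forest-graph : Graph n
  forest-graph .adj = F
  forest-graph .symmetric u v = T-ext (F-sym φ) (F-sym φ)
  forest-graph .loopless u = T-ext {F u u} {false} (F-irrefl φ) (λ ())
  forest-graph .nonempty = n≢0
  forest-graph .connected u v = star⇒walk (R⊆F* φ (total u v))

  forest-graph-acyclic : Acyclic forest-graph
  forest-graph-acyclic w u 2≤ℓ vu = bridge φ (F-sym φ vu) (path-avoids w u 2≤ℓ)

anyᵛ : ∀ {n} → Sub n → Bool
anyᵛ P = fold (λ u b → P u ∨ b) false

anyᵛ⁺ : ∀ {n} (P : Sub n) {u} → T (P u) → T (anyᵛ P)
anyᵛ⁺ P {zero}  p = ∨⁺ (inj₁ p)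
anyᵛ⁺ P {suc u} p = ∨⁺ {P zero} (inj₂ (anyᵛ⁺ (P ∘ suc) p))

anyᵛ⁻ : ∀ {n} (P : Sub n) → T (anyᵛ P) → ∃ λ u → T (P u)
anyᵛ⁻ {suc n} P p with ∨⁻ {P zero} p
... | inj₁ q = zero , q
... | inj₂ q = let u , r = anyᵛ⁻ (P ∘ suc) q in suc u , r

expand : ∀ {n} → Matrix n → Sub n → Sub n
expand E B x = B x ∨ anyᵛ (λ w → B w ∧ E w x)

frontier : ∀ {n} → Matrix n → Sub n → Matrix n
frontier E B u v = B u ∧ not (B v) ∧ E u v

-- One round of breadth-first search from all roots at once
sweep : ∀ {n} → Matrix n → State n × Sub n → State n × Sub n
sweep E (s , B) = grow (frontier E B) s , expand E B

bfs : ∀ {n} → Matrix n → Sub n → State n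
bfs {n} E B = proj₁ (fold {m = n} (λ _ → sweep E) (start , B))

module _ {n} {E : Matrix n} {B : Sub n} where

  expand⁻ : ∀ {x} → T (expand E B x) → T (B x) ⊎ ∃ λ w → T (B w) × ⟨ E ⟩ w x
  expand⁻ {x} p with ∨⁻ {B x} p
  ... | inj₁ q = inj₁ q
  ... | inj₂ q = let w , r = anyᵛ⁻ (λ w → B w ∧ E w x) q in inj₂ (w , ∧⁻ {B w} r)

  expand-⊇ : ∀ {x} → T (B x) → T (expand E B x)
  expand-⊇ p = ∨⁺ (inj₁ p)

  expand-edge : ∀ {w x} → T (B w) → ⟨ E ⟩ w x → T (expand E B x)
  expand-edge {w} {x} p e = ∨⁺ {B x} (inj₂ (anyᵛ⁺ (λ w → B w ∧ E w x) {w} (∧⁺ p e)))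

  frontier⁺ : ∀ {u v} → T (B u) → ¬ T (B v) → ⟨ E ⟩ u v → ⟨ frontier E B ⟩ u v
  frontier⁺ {u} p q e = ∧⁺ {B u} p (∧⁺ (not⁺ q) e)

  frontier⁻ : ∀ {u v} → ⟨ frontier E B ⟩ u v → T (B u) × ¬ T (B v) × ⟨ E ⟩ u v
  frontier⁻ {u} {v} p =
    let q , r = ∧⁻ {B u} p ; s , e = ∧⁻ {not (B v)} r in q , not⁻ {B v} s , e

module _ {n} {E : Matrix n} (E-sym : ∀ {x y} → ⟨ E ⟩ x y → ⟨ E ⟩ y x) (Root : Sub n) where

  -- Only some root is promised, because a vertex where two searches meet may link their trees.
  -- Where each component has at most one root, as in `bfs-shortest`, it is the intended one.
  Reached : Matrix n → ℕ → Fin n → Set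
  Reached F i x = ∃ λ v → T (Root v) × ∃ λ j → j ≤ i × Walk ⟨ F ⟩ x v j

  -- By `isolated`, a vertex outside `B` has no forest edge yet. Hence the first edge of a forest
  -- walk leaving a newly reached vertex is a frontier edge and leads straight into the old `B`, so
  -- that depth grows by one per sweep. In `nearest` the bound is the length of the given walk
  -- rather than the number of sweeps, which makes forest distances exact.
  record Layers (i : ℕ) (s : State n × Sub n) : Set where
    F = proj₁ (proj₁ s)
    R = proj₂ (proj₁ s)
    B = proj₂ s
    field
      isForest : IsForest F R
      F⊆E      : ∀ {x y} → ⟨ F ⟩ x y → ⟨ E ⟩ x y
      isolated : ∀ {x y} → ¬ T (B x) → ⟨ R ⟩ x y → x ≡ y
      ball     : ∀ {x v j} → j ≤ i → T (Root v) → Walk ⟨ E ⟩ x v j → T (B x)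
      reached  : ∀ {x} → T (B x) → Reached F i x
      nearest : ∀ {x v j} → j ≤ i → T (Root v) → Walk ⟨ E ⟩ x v j → Reached F j x

  open Layers

  module _ {i} {s : State n} {B : Sub n} (L : Layers i (s , B)) where

    private
      g = grow-grows (frontier E B) s (isForest L)
      F′ = proj₁ (grow (frontier E B) s)

      raise : ∀ {j k x} → j ≤ k → Reached (proj₁ s) j x → Reached F′ k x
      raise j≤k (v , root , l , l≤ , w) = v , root , l , ≤-trans l≤ j≤k , walk-map (F-mono g) w

      attached : ∀ {u x} → ¬ T (B x) → T (B u) → Star ⟨ F′ ⟩ x u → ∃ λ z → T (B z) × ⟨ F′ ⟩ x z
      attached ¬Bx Bu ε = contradiction Bu ¬Bx
      attached {x = x} ¬Bx Bu (_◅_ {j = z} xz _) with F-new g {x} {z} xz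
      ... | inj₂ (inj₁ e) = contradiction (proj₁ (frontier⁻ {E = E} {B} e)) ¬Bx
      ... | inj₂ (inj₂ e) = z , proj₁ (frontier⁻ {E = E} {B} e) , xz
      ... | inj₁ old with isolated L ¬Bx (F⊆R (isForest L) old)
      ...   | refl = contradiction xz (F-irrefl (forest g) {x})

      connection : ∀ {u x} → ¬ T (B x) → T (B u) → ⟨ E ⟩ u x → Star ⟨ F′ ⟩ x u
      connection {u} {x} ¬Bx Bu ux = R⊆F* (forest g) {x} {u} (symm (R-equiv (forest g)) {u} {x}
        (grow-joins (frontier E B) s (isForest L) {u} {x} (frontier⁺ {E = E} Bu ¬Bx ux)))

      reached′ : ∀ {x} → T (expand E B x) → Reached F′ (suc i) x
      reached′ {x} p with B x in eq | expand⁻ {E = E} {B} {x} p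
      ... | true  | _ = raise (n≤1+n i) (reached L (subst T (sym eq) _))
      ... | false | inj₂ (u , Bu , ux)
        with attached (subst T eq) Bu (connection (subst T eq) Bu ux)
      ...   | u′ , Bu′ , xu′ with reached L Bu′
      ...     | v , root , l , l≤ , w =
        v , root , suc l , s≤s l≤ , xu′ ∷ walk-map (F-mono g) w

      ball′ : ∀ {x v j} → j ≤ suc i → T (Root v) → Walk ⟨ E ⟩ x v j → T (expand E B x)
      ball′ _ root [] = expand-⊇ {E = E} {B} (ball L z≤n root [])
      ball′ (s≤s j≤i) root (e ∷ w) = expand-edge {E = E} {B} (ball L j≤i root w) (E-sym e)

    sweep-layers : Layers (suc i) (sweep E (s , B))
    sweep-layers .isForest = forest g
    sweep-layers .F⊆E {x} {y} p with F-new g {x} {y} p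
    ... | inj₁ q        = F⊆E L q
    ... | inj₂ (inj₁ q) = proj₂ (proj₂ (frontier⁻ {E = E} {B} q))
    ... | inj₂ (inj₂ q) = E-sym (proj₂ (proj₂ (frontier⁻ {E = E} {B} q)))
    sweep-layers .isolated {x} {y} ¬Bx p = alone (R⊆F* (forest g) {x} {y} p)
      where
      alone : Star ⟨ F′ ⟩ x y → x ≡ y
      alone ε = refl
      alone (_◅_ {j = z} xz _) with F-new g {x} {z} xz
      ... | inj₂ (inj₁ q) =
        contradiction (expand-⊇ {E = E} {B} (proj₁ (frontier⁻ {E = E} {B} q))) ¬Bx
      ... | inj₂ (inj₂ q) =
        let Bz , _ , e = frontier⁻ {E = E} {B} q in
        contradiction (expand-edge {E = E} {B} Bz e) ¬Bx
      ... | inj₁ q with isolated L (¬Bx ∘ expand-⊇ {E = E} {B}) (F⊆R (isForest L) q)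
      ...   | refl = contradiction xz (F-irrefl (forest g) {x})
    sweep-layers .ball = ball′
    sweep-layers .reached = reached′
    sweep-layers .nearest {j = j} j≤ root w with m≤n⇒m<n∨m≡n j≤
    ... | inj₁ (s≤s j≤i) = raise ≤-refl (nearest L j≤i root w)
    ... | inj₂ refl      = reached′ (ball′ ≤-refl root w)

  bfs-layers : ∃ λ B → Layers n (bfs E Root , B)
  bfs-layers = _ , fold-counts Layers (λ _ → sweep E) (λ _ _ _ → sweep-layers) (start , Root) record
    { isForest = empty-isForest
    ; F⊆E      = λ ()
    ; isolated = λ {x} {y} _ p → toWitness p
    ; ball     = λ { z≤n root [] → root }
    ; reached  = λ root → _ , root , 0 , z≤n , []
    ; nearest = λ { z≤n root [] → _ , root , 0 , z≤n , [] }
    }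

  bfs-isForest : IsForest (proj₁ (bfs E Root)) (proj₂ (bfs E Root))
  bfs-isForest = isForest (proj₂ bfs-layers)

  bfs-⊆ : ∀ {x y} → ⟨ proj₁ (bfs E Root) ⟩ x y → ⟨ E ⟩ x y
  bfs-⊆ {x} {y} = F⊆E (proj₂ bfs-layers) {x} {y}

  -- Only n sweeps are made, so the walk is first cut down to fewer than n steps. The root that
  -- `nearest` then returns lies in the component of `v` and must be `v`.
  bfs-shortest : (∀ {u v} → T (Root u) → T (Root v) → Star ⟨ E ⟩ u v → u ≡ v) →
                 ∀ {x v j} → T (Root v) → Walk ⟨ E ⟩ x v j →
                 ∃ λ l → l ≤ j × Walk ⟨ proj₁ (bfs E Root) ⟩ x v l
  bfs-shortest unique root w with shorten w
  ... | m , m≤j , m<n , w′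
    with nearest (proj₂ bfs-layers) (<⇒≤ m<n) root w′
  ...   | v′ , root′ , l , l≤m , p
    with unique root′ root
           (reverse E-sym (gmap id (F⊆E (proj₂ bfs-layers)) (walk⇒star p)) ◅◅ walk⇒star w′)
  ...     | refl = l , ≤-trans l≤m m≤j , p

-- Balanced separators

count : ∀ {n} → Sub n → ℕ
count X = fold (λ u c → if X u then suc c else c) 0

-- 2 · |X| ≤ |Y|
half : ∀ {n} → Sub n → Sub n → Bool
half X Y = fold (λ u c → if Y u then pred c else c)
             (fold (λ u c → if X u then suc (suc c) else c) 0) ≡ᵇ 0

fold-pred : ∀ {n} (Y : Sub n) m → fold (λ u c → if Y u then pred c else c) m ≡ m ∸ count Y
fold-pred {zero}  Y m = refl
fold-pred {suc n} Y m with Y zero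
... | true  = trans (cong pred (fold-pred (Y ∘ suc) m)) (pred[m∸n]≡m∸[1+n] m (count (Y ∘ suc)))
... | false = fold-pred (Y ∘ suc) m

fold-suc-suc : ∀ {n} (X : Sub n) → fold (λ u c → if X u then suc (suc c) else c) 0 ≡ 2 * count X
fold-suc-suc {zero}  X = refl
fold-suc-suc {suc n} X with X zero
... | true  = trans (cong (2 +_) (fold-suc-suc (X ∘ suc))) (sym (*-suc 2 (count (X ∘ suc))))
... | false = fold-suc-suc (X ∘ suc)

half-∸ : ∀ {n} (X Y : Sub n) → half X Y ≡ (2 * count X ∸ count Y ≡ᵇ 0)
half-∸ X Y = cong (_≡ᵇ 0) (trans (fold-pred Y _) (cong (_∸ count Y) (fold-suc-suc X)))

half⁺ : ∀ {n} {X Y : Sub n} → 2 * count X ≤ count Y → T (half X Y)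
half⁺ {X = X} {Y} p = subst T (sym (half-∸ X Y)) (≡⇒≡ᵇ _ 0 (m≤n⇒m∸n≡0 p))

half⁻ : ∀ {n} {X Y : Sub n} → T (half X Y) → 2 * count X ≤ count Y
half⁻ {X = X} {Y} p = m∸n≡0⇒m≤n (≡ᵇ⇒≡ _ 0 (subst T (half-∸ X Y) p))

_⊆ᵛ_ : ∀ {n} → Sub n → Sub n → Set
X ⊆ᵛ Y = ∀ {u} → T (X u) → T (Y u)

count-mono : ∀ {n} {X Y : Sub n} → X ⊆ᵛ Y → count X ≤ count Y
count-mono {zero} X⊆Y = z≤n
count-mono {suc n} {X} {Y} X⊆Y with X zero | Y zero | X⊆Y {zero}
... | true  | true  | _ = s≤s (count-mono {X = X ∘ suc} X⊆Y)
... | true  | false | f = contradiction _ f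
... | false | true  | _ = m≤n⇒m≤1+n (count-mono {X = X ∘ suc} X⊆Y)
... | false | false | _ = count-mono {X = X ∘ suc} X⊆Y

count-strict : ∀ {n} {X Y : Sub n} → X ⊆ᵛ Y → ∀ u → ¬ T (X u) → T (Y u) → count X < count Y
count-strict {suc n} {X} {Y} X⊆Y zero ¬Xu Yu with X zero | Y zero
... | true  | _    = contradiction _ ¬Xu
... | false | true = s≤s (count-mono {X = X ∘ suc} X⊆Y)
count-strict {suc n} {X} {Y} X⊆Y (suc u) ¬Xu Yu with X zero | Y zero | X⊆Y {zero}
... | true  | true  | _ = s≤s (count-strict {X = X ∘ suc} X⊆Y u ¬Xu Yu)
... | true  | false | f = contradiction _ f
... | false | true  | _ = m≤n⇒m≤1+n (count-strict {X = X ∘ suc} X⊆Y u ¬Xu Yu)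
... | false | false | _ = count-strict {X = X ∘ suc} X⊆Y u ¬Xu Yu

count-disjoint : ∀ {n} {X Y Z : Sub n} → X ⊆ᵛ Z → Y ⊆ᵛ Z → (∀ u → ¬ (T (X u) × T (Y u))) →
                 count X + count Y ≤ count Z
count-disjoint {zero} _ _ _ = z≤n
count-disjoint {suc n} {X} {Y} {Z} X⊆Z Y⊆Z disj
  with X zero | Y zero | Z zero | X⊆Z {zero} | Y⊆Z {zero} | disj zero
     | count-disjoint {X = X ∘ suc} {Y ∘ suc} {Z ∘ suc} X⊆Z Y⊆Z (disj ∘ suc)
... | true  | true  | _     | _ | _ | d | _  = contradiction (_ , _) d
... | true  | false | true  | _ | _ | _ | ih = s≤s ih
... | true  | false | false | f | _ | _ | _  = contradiction _ f
... | false | true  | true  | _ | _ | _ | ih =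
  ≤-trans (≤-reflexive (+-suc (count (X ∘ suc)) _)) (s≤s ih)
... | false | true  | false | _ | f | _ | _  = contradiction _ f
... | false | false | true  | _ | _ | _ | ih = m≤n⇒m≤1+n ih
... | false | false | false | _ | _ | _ | ih = ih

count-≤ : ∀ {n} (X : Sub n) → count X ≤ n
count-≤ {zero} X = z≤n
count-≤ {suc n} X with X zero
... | true  = s≤s (count-≤ (X ∘ suc))
... | false = m≤n⇒m≤1+n (count-≤ (X ∘ suc))

count-nonempty : ∀ {n} {X : Sub n} {u} → T (X u) → 1 ≤ count X
count-nonempty {X = X} {u} p =
  ≤-trans (s≤s z≤n) (count-strict {X = λ _ → false} {X} (λ ()) u (λ ()) p)

majorities-meet : ∀ {n} {X Y Z : Sub n} → X ⊆ᵛ Z → Y ⊆ᵛ Z →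
                  count Z < 2 * count X → count Z < 2 * count Y → ∃ λ u → T (X u) × T (Y u)
majorities-meet {X = X} {Y} {Z} X⊆Z Y⊆Z p q with T? (anyᵛ (λ u → X u ∧ Y u))
... | yes r = let u , s = anyᵛ⁻ _ r in u , ∧⁻ {X u} s
... | no ¬r = contradiction (begin-strict
  2 * count Z               ≡⟨ cong (count Z +_) (+-identityʳ (count Z)) ⟩
  count Z + count Z         <⟨ +-mono-< p q ⟩
  2 * count X + 2 * count Y ≡⟨ *-distribˡ-+ 2 (count X) (count Y) ⟨
  2 * (count X + count Y)   ≤⟨ *-monoʳ-≤ 2 (count-disjoint {X = X} {Y} {Z} X⊆Z Y⊆Z
                                 (λ { u (a , b) → ¬r (anyᵛ⁺ (λ u → X u ∧ Y u) {u} (∧⁺ a b)) })) ⟩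
  2 * count Z               ∎) (<-irrefl refl)
  where open ≤-Reasoning

inside : ∀ {n} → Matrix n → Sub n → Matrix n
inside E X u v = X u ∧ X v ∧ E u v

_∖_ : ∀ {n} → Sub n → Sub n → Sub n
(X ∖ Y) u = X u ∧ not (Y u)

balanced : ∀ {n} → Matrix n → Sub n → Sub n → Bool
balanced E X S = not (anyᵛ λ u → (X ∖ S) u ∧ not (half (components (inside E (X ∖ S)) u) X))

module _ {n} {E : Matrix n} {X : Sub n} where

  inside⁺ : ∀ {u v} → T (X u) → T (X v) → ⟨ E ⟩ u v → ⟨ inside E X ⟩ u v
  inside⁺ {u} {v} p q e = ∧⁺ {X u} p (∧⁺ {X v} q e)

  inside⁻ : ∀ {u v} → ⟨ inside E X ⟩ u v → T (X u) × T (X v) × ⟨ E ⟩ u v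
  inside⁻ {u} {v} p = let a , q = ∧⁻ {X u} p in a , ∧⁻ {X v} q

  inside-sym : (∀ {u v} → ⟨ E ⟩ u v → ⟨ E ⟩ v u) → ∀ {u v} → ⟨ inside E X ⟩ u v → ⟨ inside E X ⟩ v u
  inside-sym sym {u} {v} p = let a , b , e = inside⁻ {u} {v} p in inside⁺ {v} {u} b a (sym e)

  inside-stays : ∀ {u v} → T (X u) → Star ⟨ inside E X ⟩ u v → T (X v)
  inside-stays p ε = p
  inside-stays {u} p (_◅_ {j = w} e s) = inside-stays (proj₁ (proj₂ (inside⁻ {u} {w} e))) s

∖⁺ : ∀ {n} {X Y : Sub n} {u} → T (X u) → ¬ T (Y u) → T ((X ∖ Y) u)
∖⁺ p q = ∧⁺ p (not⁺ q)

∖⁻ : ∀ {n} {X Y : Sub n} {u} → T ((X ∖ Y) u) → T (X u) × ¬ T (Y u)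
∖⁻ {X = X} {Y} {u} p = let a , b = ∧⁻ {X u} p in a , not⁻ {Y u} b

module _ {n} {E : Matrix n} {X S : Sub n} where

  balanced⁻ : T (balanced E X S) → ∀ {u} → T ((X ∖ S) u) →
              2 * count (components (inside E (X ∖ S)) u) ≤ count X
  balanced⁻ p {u} q with T? (half (components (inside E (X ∖ S)) u) X)
  ... | yes h = half⁻ {X = components (inside E (X ∖ S)) u} {X} h
  ... | no ¬h = contradiction
    (anyᵛ⁺ (λ u → (X ∖ S) u ∧ not (half (components (inside E (X ∖ S)) u) X)) {u} (∧⁺ q (not⁺ ¬h)))
    (not⁻ p)

  ¬balanced : ¬ T (balanced E X S) → ∃ λ u → T ((X ∖ S) u) ×
              count X < 2 * count (components (inside E (X ∖ S)) u)
  ¬balanced ¬p with T? (anyᵛ λ u → (X ∖ S) u ∧ not (half (components (inside E (X ∖ S)) u) X))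
  ... | no ¬q = contradiction (not⁺ ¬q) ¬p
  ... | yes q with anyᵛ⁻ (λ u → (X ∖ S) u ∧ not (half (components (inside E (X ∖ S)) u) X)) q
  ...   | u , r = let a , b = ∧⁻ {(X ∖ S) u} r in
    u , a , ≰⇒> (not⁻ b ∘ half⁺ {X = components (inside E (X ∖ S)) u} {X})

-- Balanced bags in tree decompositions

Adj-sym : ∀ {n} (G : Graph n) {u v} → Adj G u v → Adj G v u
Adj-sym G {u} {v} = subst T (symmetric G u v)

Adj-irrefl : ∀ {n} (G : Graph n) {u} → ¬ Adj G u u
Adj-irrefl G {u} = subst T (loopless G u)

-- Shorten a detour to a path. Length zero would make the edge a loop, length one would be the
-- excluded edge itself, and anything longer is closed to a cycle by the edge.
acyclic⇒bridge : ∀ {n} (G : Graph n) → Acyclic G → ∀ {u v} → Adj G u v →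
                 ¬ Star (Without (Adj G) u v) u v
acyclic⇒bridge G acyclic {u} {v} uv s with walk⇒path (proj₂ (star⇒walk s))
... | 0 , _ , [] , _ = Adj-irrefl G uv
... | 1 , _ , (_ , ¬ends) ∷ [] , _ = ¬ends (inj₁ (refl , refl))
... | suc (suc _) , _ , w , unique =
  acyclic (walk-map proj₁ w) (subst (λ xs → Unique xs) (sym (vertices-map proj₁ w)) unique)
          (s≤s (s≤s z≤n)) (Adj-sym G uv)

vertex₀ : ∀ {n} → NonZero n → Fin n
vertex₀ {suc _} _ = zero

-- In a tree decomposition without a balanced bag, each node i points to the
-- neighbour j in whose direction the heavy component at i lies.  The part of
-- the tree beyond j shrinks from step to step, and no edge is followed back
-- and forth since two heavy components intersect.
module _ {n} {G : Graph n} (D : TreeDecomposition G) (X : Sub n) (S : Fin (size D) → Sub n)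
         (bag⊆S : ∀ i {v} → v Subset.∈ bag D i → T (S i v)) where

  private
    m = size D
    t = tree D

    away : Fin m → Matrix m
    away i a b = adj t a b ∧ not (equal a i) ∧ not (equal b i)

    away⁺ : ∀ {i a b} → Adj t a b → a ≢ i → b ≢ i → ⟨ away i ⟩ a b
    away⁺ {i} {a} {b} e p q = ∧⁺ {adj t a b} e
      (∧⁺ (not⁺ {equal a i} (p ∘ toWitness)) (not⁺ {equal b i} (q ∘ toWitness)))

    away⁻ : ∀ {i a b} → ⟨ away i ⟩ a b → Adj t a b × a ≢ i × b ≢ i
    away⁻ {i} {a} {b} p =
      let e , q = ∧⁻ {adj t a b} p ; r , s = ∧⁻ {not (equal a i)} q in
      e , (λ a≡i → not⁻ {equal a i} r (fromWitness a≡i)) ,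
          (λ b≡i → not⁻ {equal b i} s (fromWitness b≡i))

    Side : Fin m → Fin m → Fin m → Set
    Side i j a = Star ⟨ away i ⟩ j a

    away-sym : ∀ i {a b} → ⟨ away i ⟩ a b → ⟨ away i ⟩ b a
    away-sym i {a} {b} p = let e , q , r = away⁻ {i} {a} {b} p in away⁺ (Adj-sym t e) r q

    side-end : ∀ {i j a} → j ≢ i → Side i j a → a ≢ i
    side-end j≢i ε = j≢i
    side-end {i} {j} j≢i (_◅_ {j = b} e s) = side-end (proj₂ (proj₂ (away⁻ {i} {j} {b} e))) s

    adj⇒≢ : ∀ {i j} → Adj t i j → j ≢ i
    adj⇒≢ e refl = Adj-irrefl t e

    -- The neighbour `j` is the node after the last visit of the walk to `i`; the remainder from
    -- there avoids `i`.
    toward : ∀ {i a x} → a ≢ i → Star (Adj t) x a → Side i x a ⊎ ∃ λ j → Adj t i j × Side i j a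
    toward a≢i ε = inj₁ ε
    toward {i} {a} {x} a≢i (_◅_ {j = y} e s) with toward a≢i s
    ... | inj₂ r = inj₂ r
    ... | inj₁ r with x ≟ i | y ≟ i
    ...   | yes refl | _        = inj₂ (y , e , r)
    ...   | no x≢i   | no y≢i   = inj₁ (away⁺ {i} {x} {y} e x≢i y≢i ◅ r)
    ...   | no _     | yes refl = inj₂ (stuck r)
      where
      stuck : Side i i a → ∃ λ j → Adj t i j × Side i j a
      stuck ε = contradiction refl a≢i
      stuck (_◅_ {j = z} e _) = contradiction refl (proj₁ (proj₂ (away⁻ {i} {i} {z} e)))

    rest : Fin m → Matrix n
    rest i = inside (adj G) (X ∖ S i)

    record Heavy (i : Fin m) : Set where
      field
        centre   : Fin n
        centre∈  : T ((X ∖ S i) centre)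
        majority : count X < 2 * count (components (rest i) centre)

      part : Sub n
      part = components (rest i) centre

      part* : ∀ {v} → T (part v) → Star ⟨ rest i ⟩ centre v
      part* = components-sound (rest i) λ {u} {v} →
              inside-sym {E = adj G} {X ∖ S i} (λ {u} {v} → Adj-sym G {u} {v}) {u} {v}

      part⊆X : part ⊆ᵛ X
      part⊆X {v} p = proj₁ (∖⁻ {X = X} {S i} (inside-stays {E = adj G} {X ∖ S i} centre∈ (part* p)))

    open Heavy

    off-node : ∀ {i v a} → T ((X ∖ S i) v) → v Subset.∈ bag D a → a ≢ i
    off-node {i} {v} p v∈ refl = proj₂ (∖⁻ {X = X} {S i} {v} p) (bag⊆S i v∈)

    -- The nodes whose bags contain `v` are connected to each other, and `i` is not among them since
    -- `v` lies outside `S i`, which contains the bag of `i`.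
    same-side : ∀ {i j v a b} → T ((X ∖ S i) v) → v Subset.∈ bag D a → v Subset.∈ bag D b →
                Side i j a → Side i j b
    same-side {i} {v = v} p v∈a v∈b s = s ◅◅ gmap id
      (λ { {a} {b} (e , q , r) →
           away⁺ {i} {a} {b} e (off-node {v = v} p q) (off-node {v = v} p r) })
      (walk⇒star (proj₂ (bags-connected D v v∈a v∈b)))

    Beyond : ∀ i → Fin m → Heavy i → Set
    Beyond i j h = ∀ {v a} → T (part h v) → v Subset.∈ bag D a → Side i j a

    spread : ∀ {i j u v} → T ((X ∖ S i) u) → Star ⟨ rest i ⟩ u v →
             (∀ {a} → u Subset.∈ bag D a → Side i j a) → ∀ {a} → v Subset.∈ bag D a → Side i j a
    spread p ε f = f
    spread {i} {u = u} p (_◅_ {j = w} e s) f =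
      let _ , q , uw = inside⁻ {E = adj G} {X ∖ S i} {u} {w} e
          b , u∈b , w∈b = covers-edge D uw
      in spread q s (λ w∈a → same-side {v = w} q w∈b w∈a (f u∈b))

    -- Adjacent vertices share a bag and no vertex of the heavy component lies in the bag of `i`, so
    -- the side on which its centre is found spreads to the whole component.
    direction : ∀ {i} (h : Heavy i) → ∃ λ j → Adj t i j × Beyond i j h
    direction {i} h with covers-vertex D (centre h)
    ... | a , u∈a with toward {i} {a} (off-node {v = centre h} (centre∈ h) u∈a)
                         (walk⇒star (proj₂ (connected t i a)))
    ...   | inj₁ ε = contradiction refl (off-node {v = centre h} (centre∈ h) u∈a)
    ...   | inj₁ (_◅_ {j = z} e _) = contradiction refl (proj₁ (proj₂ (away⁻ {i} {i} {z} e)))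
    ...   | inj₂ (j , e , s) = j , e , λ v∈ →
      spread (centre∈ h) (part* h v∈) (λ u∈b → same-side {v = centre h} (centre∈ h) u∈a u∈b s)

    keep-off : ∀ {i j a b} → Side i a b → Star (Without (Adj t) i j) a b
    keep-off {i} = gmap id λ {a} {b} e →
      let e′ , p , q = away⁻ {i} {a} {b} e in
      e′ , λ { (inj₁ (refl , _)) → p refl ; (inj₂ (_ , refl)) → q refl }

    keep-off′ : ∀ {i j a b} → Side j a b → Star (Without (Adj t) i j) a b
    keep-off′ {j = j} = gmap id λ {a} {b} e →
      let e′ , p , q = away⁻ {j} {a} {b} e in
      e′ , λ { (inj₁ (_ , refl)) → q refl ; (inj₂ (refl , _)) → p refl }

    without-sym : ∀ {i j a b} → Without (Adj t) i j a b → Without (Adj t) i j b a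
    without-sym (e , ¬ends) = Adj-sym t e , ¬ends ∘ Ends-sym

    bridge-t : ∀ {i j} → Adj t i j → ¬ Star (Without (Adj t) i j) i j
    bridge-t = acyclic⇒bridge t (tree-acyclic D)

    -- A walk from `j` that avoids `i` and a walk from `i` that avoids `j` both miss the edge
    -- between them. If both ended in `a`, they would bypass this bridge.
    opposite : ∀ {i j a} → Adj t i j → Side i j a → Side j i a → ∀ {A : Set} → A
    opposite ij p q =
      contradiction (keep-off′ q ◅◅ reverse without-sym (keep-off p)) (bridge-t ij)

    -- A walk from `l` that avoids `j` cannot reach `i`: together with the step from `j` to `l` it
    -- would lead from `j` to `i` around a bridge.
    shrink : ∀ {i j l a} → Adj t i j → Adj t j l → l ≢ i → Side j l a → Side i l a
    shrink ij jl l≢i ε = ε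
    shrink {i} {j} {l} ij jl l≢i (_◅_ {j = b} e s) with away⁻ {j} {l} {b} e
    ... | lb , l≢j , b≢j = go l≢i (e ◅ s) ε
      where
      beyond : ∀ {x} → Side j l x → x ≢ i
      beyond p refl = bridge-t ij (reverse without-sym
        ((Adj-sym t (Adj-sym t jl) , λ { (inj₁ (refl , _)) → adj⇒≢ ij refl
                                        ; (inj₂ (_ , refl)) → l≢i refl }) ◅ keep-off′ p))
      go : ∀ {x a} → x ≢ i → Side j x a → Side j l x → Side i x a
      go x≢i ε p = ε
      go {x} x≢i (_◅_ {j = y} e s) p =
        let xy , _ , _ = away⁻ {j} {x} {y} e
            p′ = p ◅◅ e ◅ ε
        in away⁺ {i} {x} {y} xy x≢i (beyond p′) ◅ go (beyond p′) s p′

    side : Fin m → Fin m → Sub m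
    side i j = components (away i) j

    side⁺ : ∀ {i j a} → Side i j a → T (side i j a)
    side⁺ {i} = components-complete (away i)

    side⁻ : ∀ {i j a} → T (side i j a) → Side i j a
    side⁻ {i} = components-sound (away i) λ {a} {b} → away-sym i {a} {b}

    side-strict : ∀ {i j l} → Adj t i j → Adj t j l → l ≢ i → count (side j l) < count (side i j)
    side-strict {i} {j} {l} ij jl l≢i = count-strict
      (λ {a} p → side⁺ {i} (away⁺ {i} {j} {l} jl (adj⇒≢ ij) l≢i ◅ shrink ij jl l≢i (side⁻ {j} p)))
      j (λ p → side-end (adj⇒≢ jl) (side⁻ {j} p) refl) (side⁺ {i} ε)

    descent : (h : ∀ i → Heavy i) → ∀ f i j → Adj t i j → Beyond i j (h i) → count (side i j) ≤ f →
              ∀ {A : Set} → A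
    descent h f i j ij beyond bound with direction (h j)
    ... | l , jl , beyond′ with l ≟ i
    ...   | yes refl =
      let v , p , q = majorities-meet {X = part (h i)} {part (h j)} {X}
                        (part⊆X (h i)) (part⊆X (h j))
                        (majority (h i)) (majority (h j))
          a , v∈a = covers-vertex D v
      in opposite ij (beyond {v} p v∈a) (beyond′ {v} q v∈a)
    ...   | no l≢i with ≤-trans (side-strict ij jl l≢i) bound
    ...     | s≤s bound′ = descent h _ j l jl beyond′ bound′

  balanced-bag : ∃ λ i → T (balanced (adj G) X (S i))
  balanced-bag with any? (λ i → T? (balanced (adj G) X (S i)))
  ... | yes p = p
  ... | no ¬p = start-anywhere
    where
    heavy : ∀ i → Heavy i
    heavy i = let u , u∈ , big = ¬balanced {E = adj G} {X} {S i} (λ b → ¬p (i , b)) in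
      record { centre = u ; centre∈ = u∈ ; majority = big }
    i₀ = vertex₀ (nonempty t)
    start-anywhere : ∃ λ i → T (balanced (adj G) X (S i))
    start-anywhere = let j , e , beyond = direction (heavy i₀) in
      descent heavy (count (side i₀ j)) i₀ j e beyond ≤-refl

-- k centres together with the union of the disks around them
candidate : ℕ → Ty
candidate zero    = table bool
candidate (suc k) = vertex ×ᵗ candidate k

zone : ∀ k {n} → ⟪ candidate k ⟫ n → Sub n
zone zero    S       = S
zone (suc k) (_ , c) = zone k c

centre : ∀ {k n} → Fin k → ⟪ candidate k ⟫ n → Fin n
centre zero    (v , _) = v
centre (suc i) (_ , c) = centre i c

-- Searching for k centres with the least separating radius

firstJust : ∀ {A : Set} {n} → (Fin n → Maybe A) → Maybe A
firstJust f = fold (λ v r → maybe′ just r (f v)) nothing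

firstJust-sound : ∀ {A : Set} {n} (f : Fin n → Maybe A) {c} →
                  firstJust f ≡ just c → ∃ λ v → f v ≡ just c
firstJust-sound {n = suc n} f eq with f zero in eq₀
... | just _  = zero , trans eq₀ eq
... | nothing = let v , p = firstJust-sound (f ∘ suc) eq in suc v , p

firstJust-complete : ∀ {A : Set} {n} (f : Fin n → Maybe A) v → f v ≢ nothing → firstJust f ≢ nothing
firstJust-complete f zero    p with f zero
... | just _  = λ ()
... | nothing = contradiction refl p
firstJust-complete f (suc v) p with f zero
... | just _  = λ ()
... | nothing = firstJust-complete (f ∘ suc) v p

module _ {n} (E : Matrix n) (X : Sub n) where

  extendBy : ∀ {k} → Fin n → Maybe (⟪ candidate k ⟫ n) → Maybe (⟪ candidate (suc k) ⟫ n)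
  extendBy v = maybe′ (λ c → just (v , c)) nothing

  -- S is the union of the disks, given by the rows of M, chosen so far.
  try : Matrix n → ∀ k → Sub n → Maybe (⟪ candidate k ⟫ n)
  try M zero    S = if balanced E X S then just S else nothing
  try M (suc k) S = firstJust λ v → extendBy {k} v (try M k (λ u → S u ∨ M v u))

  attempt : ∀ k → Matrix n × Maybe (⟪ candidate k ⟫ n) → Matrix n × Maybe (⟪ candidate k ⟫ n)
  attempt k (M , r) = (λ v → expand E (M v)) , maybe′ just (try M k (λ _ → false)) r

  -- Before round r, M v is the disk of radius r around v.
  search : ∀ k → Maybe (⟪ candidate k ⟫ n)
  search k = proj₂ (fold {m = n} (λ _ → attempt k) (equal , nothing))

  extendBy-just : ∀ {k v} m {c} → extendBy {k} v m ≡ just c → ∃ λ c′ → m ≡ just c′ × c ≡ (v , c′)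
  extendBy-just (just c′) refl = c′ , refl , refl

  extendBy-nothing : ∀ {k v} m → m ≢ nothing → extendBy {k} v m ≢ nothing
  extendBy-nothing (just _) _ ()
  extendBy-nothing nothing  p = contradiction refl p

  try-sound : ∀ M k S {c} → try M k S ≡ just c → T (balanced E X (zone k c)) ×
              (∀ {u} → T (zone k c u) → T (S u) ⊎ ∃ λ i → T (M (centre i c) u))
  try-sound M zero S eq with balanced E X S in bal
  try-sound M zero S refl | true = subst T (sym bal) _ , inj₁
  try-sound M (suc k) S {c} eq
    with firstJust-sound (λ v → extendBy {k} v (try M k (λ u → S u ∨ M v u))) eq
  ... | v , eq′ with extendBy-just {k} (try M k (λ u → S u ∨ M v u)) eq′
  ...   | c′ , eq″ , refl with try-sound M k _ eq″
  ...     | bal , covered = bal , split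
    where
    split : ∀ {u} → T (zone k c′ u) → T (S u) ⊎ ∃ λ i → T (M (centre i (v , c′)) u)
    split {u} p with covered p
    ... | inj₂ (i , q) = inj₂ (suc i , q)
    ... | inj₁ q with ∨⁻ {S u} q
    ...   | inj₁ r = inj₁ r
    ...   | inj₂ r = inj₂ (zero , r)

  -- This is the set that `try` accumulates along one fixed choice of centres. The disjunctions are
  -- nested exactly as there, so a balanced cover is literally the test that `try` performs.
  cover : Matrix n → ∀ k → (Fin k → Fin n) → Sub n → Sub n
  cover M zero    c S = S
  cover M (suc k) c S = cover M k (c ∘ suc) (λ u → S u ∨ M (c zero) u)

  cover-⊇ : ∀ M k (c : Fin k → Fin n) S {u} → T (S u) → T (cover M k c S u)
  cover-⊇ M zero    c S p = p
  cover-⊇ M (suc k) c S p = cover-⊇ M k (c ∘ suc) _ (∨⁺ (inj₁ p))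

  cover-disk : ∀ M k (c : Fin k → Fin n) S i {u} → T (M (c i) u) → T (cover M k c S u)
  cover-disk M (suc k) c S zero    {u} p = cover-⊇ M k (c ∘ suc) _ (∨⁺ {S u} (inj₂ p))
  cover-disk M (suc k) c S (suc i)     p = cover-disk M k (c ∘ suc) _ i p

  try-complete : ∀ M k (c : Fin k → Fin n) S → T (balanced E X (cover M k c S)) →
                 try M k S ≢ nothing
  try-complete M zero c S p with balanced E X S
  ... | true = λ ()
  try-complete M (suc k) c S p =
    firstJust-complete (λ v → extendBy {k} v (try M k (λ u → S u ∨ M v u))) (c zero)
      (extendBy-nothing {k} _ (try-complete M k (c ∘ suc) _ p))

  record IsDisk (r : ℕ) (M : Matrix n) : Set where
    field
      disk⁻ : ∀ {u v} → T (M v u) → ∃ λ l → l ≤ r × Walk ⟨ E ⟩ u v l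
      disk⁺ : ∀ {u v l} → l ≤ r → Walk ⟨ E ⟩ u v l → T (M v u)

  open IsDisk

  record Separates (r : ℕ) {k} (c : ⟪ candidate k ⟫ n) : Set where
    field
      balances : T (balanced E X (zone k c))
      near     : ∀ {u} → T (zone k c u) → ∃ λ i → ∃ λ l → l ≤ r × Walk ⟨ E ⟩ u (centre i c) l

  module _ (E-sym : ∀ {u v} → ⟨ E ⟩ u v → ⟨ E ⟩ v u) where

    expand-isDisk : ∀ {r M} → IsDisk r M → IsDisk (suc r) (λ v → expand E (M v))
    expand-isDisk {r} {M} D .disk⁻ {u} {v} p with expand⁻ {E = E} {M v} p
    ... | inj₁ q = let l , l≤ , w = disk⁻ D q in l , m≤n⇒m≤1+n l≤ , w
    ... | inj₂ (x , q , e) = let l , l≤ , w = disk⁻ D q in suc l , s≤s l≤ , E-sym e ∷ w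
    expand-isDisk {r} {M} D .disk⁺ {u} {v} _ [] = expand-⊇ {E = E} {M v} (disk⁺ D z≤n [])
    expand-isDisk {r} {M} D .disk⁺ {u} {v} (s≤s l≤) (e ∷ w) =
      expand-edge {E = E} {M v} (disk⁺ D l≤ w) (E-sym e)

    equal-isDisk : IsDisk 0 equal
    equal-isDisk .disk⁻ {u} {v} p with toWitness {a? = v ≟ u} p
    ... | refl = 0 , z≤n , []
    equal-isDisk .disk⁺ {u} z≤n [] = fromWitness {a? = u ≟ u} refl

    module _ {k r} (r<n : r < n)
             (succeeds : ∀ M → IsDisk r M → try M k (λ _ → false) ≢ nothing) where

      Found : Maybe (⟪ candidate k ⟫ n) → Set
      Found m = ∃ λ c → m ≡ just c × Separates r c

      -- Without a candidate, `i` cannot have passed `r`, because the attempt with radius `r` is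
      -- bound to succeed. As `r` is below n, this alternative is impossible after n rounds; and a
      -- candidate found in round `i` has radius `i`, hence at most `r`.
      SearchInvariant : ℕ → Matrix n × Maybe (⟪ candidate k ⟫ n) → Set
      SearchInvariant i (M , m) = IsDisk i M × ((m ≡ nothing × i ≤ r) ⊎ Found m)

      attempt-progress : ∀ i s → SearchInvariant i s → SearchInvariant (suc i) (attempt k s)
      attempt-progress i (M , .(just c)) (D , inj₂ (c , refl , good)) =
        expand-isDisk D , inj₂ (c , refl , good)
      attempt-progress i (M , .nothing) (D , inj₁ (refl , i≤r)) = expand-isDisk D , outcome
        where
        outcome : (try M k (λ _ → false) ≡ nothing × suc i ≤ r) ⊎ Found (try M k (λ _ → false))
        outcome with try M k (λ _ → false) in eq
        ... | nothing = inj₁ (refl , ≤∧≢⇒< i≤r λ { refl → succeeds M D eq })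
        ... | just c  = inj₂ (c , refl , record { balances = proj₁ sound ; near = near })
          where
          sound = try-sound M k _ eq
          near : ∀ {u} → T (zone k c u) → ∃ λ i → ∃ λ l → l ≤ r × Walk ⟨ E ⟩ u (centre i c) l
          near p with proj₂ sound p
          ... | inj₂ (i , q) = let l , l≤ , w = disk⁻ D q in i , l , ≤-trans l≤ i≤r , w

      search-finds : Found (search k)
      search-finds with fold-counts SearchInvariant {n} (λ _ → attempt k)
                          (λ _ → attempt-progress) (equal , nothing)
                          (equal-isDisk , inj₁ (refl , z≤n))
      ... | _ , inj₂ found = found
      ... | _ , inj₁ (_ , n≤r) = contradiction (≤-trans r<n n≤r) (<-irrefl refl)

-- Separators in graphs of bounded tree-breadth

module _ {n} (G : Graph n) where

  dist≤ : ∀ {u v l} → Walk (Adj G) u v l → dist G u v ≤ l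
  dist≤ {u} {v} = proj₂ (dist-isMinimum G u v)

  dist<n : ∀ u v → dist G u v < n
  dist<n u v = let m , _ , m<n , w = shorten (proj₂ (connected G u v)) in
    ≤-trans (s≤s (dist≤ w)) m<n

  separator-exists : ∀ {k r} {D : TreeDecomposition G} → BagsCovered k D r → ∀ X →
                     ∀ M → IsDisk (adj G) X r M → try (adj G) X M k (λ _ → false) ≢ nothing
  separator-exists {k} {r} {D} covered X M M-disk =
    let i , bal = balanced-bag D X
                    (λ i → cover (adj G) X M k (proj₁ (covered i)) (λ _ → false)) bag⊆
    in try-complete (adj G) X M k (proj₁ (covered i)) _ bal
    where
    bag⊆ : ∀ i {v} → v Subset.∈ bag D i →
           T (cover (adj G) X M k (proj₁ (covered i)) (λ _ → false) v)
    bag⊆ i {v} v∈ =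
      let j , d≤ = proj₂ (covered i) v∈
          c = proj₁ (covered i)
      in cover-disk (adj G) X M k c (λ _ → false) j {v}
           (IsDisk.disk⁺ M-disk d≤ (proj₁ (dist-isMinimum G v (c j))))

  search-separates : ∀ {k ρ} → (∃ λ t → IsTreeBreadth k G t × t ≤ ρ) → ∀ X →
                     ∃ λ c → search (adj G) X k ≡ just c × Separates (adj G) X ρ {k} c
  search-separates {k} {ρ} (t , ((D , (covered , _)) , _) , t≤ρ) X =
    let c , eq , s = search-finds (adj G) X (λ {u} {v} → Adj-sym G {u} {v}) {k} {r} r<n
                       (separator-exists {k} {r} {D} covered′ X)
    in c , eq , record
      { balances = Separates.balances s
      ; near = λ p → let i , l , l≤ , w = Separates.near s p
                     in i , l , ≤-trans l≤ (≤-trans (m⊓n≤m t (pred n)) t≤ρ) , w }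
    where
    -- All distances are below n, so capping the breadth at `pred n` preserves the covering of the
    -- bags and keeps the radius within the n rounds of the search.
    r = t ⊓ pred n
    r<n : r < n
    r<n = ≤-trans (s≤s (m⊓n≤n t (pred n))) (≤-reflexive (suc-pred n {{nonempty G}}))
    covered′ : BagsCovered k D r
    covered′ i = let c , f = covered i in c , λ {u} u∈ →
      let j , d≤ = f u∈ in j , ⊓-glb d≤ (<⇒≤pred (dist<n u (c j)))

open Separates

-- One round: representatives, survivors, roots and spanning trees

firstImage : ∀ {n m} (P : Fin m → Bool) (g : Fin m → Fin n) → Fin n → Fin n
firstImage P g d = fold (λ v w → if P v then g v else w) d

first : ∀ {n} → Sub n → Fin n → Fin n
first P = firstImage P id

firstImage-holds : ∀ {n m} (Q : Fin n → Set) (P : Fin m → Bool) (g : Fin m → Fin n) {d} →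
                   (∀ {v} → T (P v) → Q (g v)) → Q d → Q (firstImage P g d)
firstImage-holds {m = zero}  Q P g f q = q
firstImage-holds {m = suc m} Q P g f q =
  if⁻ Q (P zero) f (λ _ → firstImage-holds Q (P ∘ suc) (g ∘ suc) f q)

first-holds : ∀ {n} (P : Sub n) {d} → T (P d) → T (P (first P d))
first-holds P = firstImage-holds (T ∘ P) P id id

firstImage-cong : ∀ {n m} (P Q : Fin m → Bool) (g : Fin m → Fin n) {d e} → (∀ v → P v ≡ Q v) →
                  ∀ v → T (P v) → firstImage P g d ≡ firstImage Q g e
firstImage-cong P Q g P≗Q zero p rewrite sym (P≗Q zero) with P zero
... | true = refl
firstImage-cong P Q g P≗Q (suc v) p rewrite sym (P≗Q zero) with P zero
... | true  = refl
... | false = firstImage-cong (P ∘ suc) (Q ∘ suc) (g ∘ suc) (P≗Q ∘ suc) v p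

first-cong : ∀ {n} (P Q : Sub n) {d e} → (∀ v → P v ≡ Q v) → ∀ v → T (P v) → first P d ≡ first Q e
first-cong P Q = firstImage-cong P Q id

module _ (k : ℕ) {n : ℕ} (E : Matrix n) (A : Sub n) where

  -- The same representative for all vertices of a component of G[A]
  leader : Fin n → Fin n
  leader u = first (components (inside E A) u) u

  part : Fin n → Sub n
  part u = components (inside E A) (leader u)

  choice : Fin n → Maybe (⟪ candidate k ⟫ n)
  choice u = search E (part u) k

  survivors : Sub n
  survivors u = A u ∧ maybe′ (λ c → not (zone k c u)) false (choice u)

  roots : Fin k → Sub n
  roots i u = A u ∧ maybe′ (λ c → equal (centre i c) u) false (choice u)

  spanner : Fin k → State n
  spanner i = grow E (bfs (inside E A) (roots i))

module _ {k n : ℕ} (G : Graph n) (A : Sub n) {ρ : ℕ}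
         (separator : ∀ X → ∃ λ c → search (adj G) X k ≡ just c × Separates (adj G) X ρ {k} c) where

  private
    E = adj G
    R = components (inside E A)
    A′ = survivors k E A

    E-sym : ∀ {u v} → ⟨ E ⟩ u v → ⟨ E ⟩ v u
    E-sym {u} {v} = Adj-sym G {u} {v}

    EA-sym : ∀ {u v} → ⟨ inside E A ⟩ u v → ⟨ inside E A ⟩ v u
    EA-sym {u} {v} = inside-sym {E = E} {A} (λ {u} {v} → E-sym {u} {v}) {u} {v}

    R-eq : IsEquivalence ⟨ R ⟩
    R-eq = components-isEquiv (inside E A)

    sep : Fin n → ⟪ candidate k ⟫ n
    sep u = proj₁ (separator (part k E A u))

    sep-separates : ∀ u → Separates E (part k E A u) ρ {k} (sep u)
    sep-separates u = proj₂ (proj₂ (separator (part k E A u)))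

    choice-sep : ∀ u → choice k E A u ≡ just (sep u)
    choice-sep u = proj₁ (proj₂ (separator (part k E A u)))

    leader-R : ∀ u → ⟨ R ⟩ u (leader k E A u)
    leader-R u = first-holds (R u) (reflx R-eq {u})

    part-self : ∀ u → T (part k E A u u)
    part-self u = symm R-eq {u} {leader k E A u} (leader-R u)

    -- Equivalent vertices have the same class, and the first element of a nonempty set does not
    -- depend on the default value. Thus a whole component agrees on one separator although each
    -- vertex computes it separately.
    leader-cong : ∀ {u v} → ⟨ R ⟩ u v → leader k E A u ≡ leader k E A v
    leader-cong {u} {v} p = first-cong (R u) (R v)
      (λ w → T-ext (transi R-eq {v} {u} {w} (symm R-eq {u} {v} p)) (transi R-eq {u} {v} {w} p))
      u (reflx R-eq {u})

    sep-cong : ∀ {u v} → ⟨ R ⟩ u v → sep u ≡ sep v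
    sep-cong p = cong (λ l → proj₁ (separator (R l))) (leader-cong p)

    star⇒R : ∀ {u v} → Star ⟨ inside E A ⟩ u v → ⟨ R ⟩ u v
    star⇒R = components-complete (inside E A)

  survivors⁻ : ∀ {u} → T (A′ u) → T (A u) × ¬ T (zone k (sep u) u)
  survivors⁻ {u} p with ∧⁻ {A u} p
  ... | a , q rewrite choice-sep u = a , not⁻ q

  removed : ∀ {u} → T (A u) → ¬ T (A′ u) → T (zone k (sep u) u)
  removed {u} a ¬p with T? (zone k (sep u) u)
  ... | yes z = z
  ... | no ¬z = contradiction (∧⁺ a alive) ¬p
    where
    alive : T (maybe′ (λ c → not (zone k c u)) false (choice k E A u))
    alive rewrite choice-sep u = not⁺ ¬z

  roots⁺ : ∀ i {u} → T (A u) → centre i (sep u) ≡ u → T (roots k E A i u)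
  roots⁺ i {u} a eq = ∧⁺ a root
    where
    root : T (maybe′ (λ c → equal (centre i c) u) false (choice k E A u))
    root rewrite choice-sep u = fromWitness {a? = centre i (sep u) ≟ u} eq

  roots⁻ : ∀ i {u} → T (roots k E A i u) → T (A u) × centre i (sep u) ≡ u
  roots⁻ i {u} p with ∧⁻ {A u} p
  ... | a , q rewrite choice-sep u = a , toWitness {a? = centre i (sep u) ≟ u} q

  -- Both vertices are the centre with index `i` of the separator shared by their component. This is
  -- the hypothesis under which the breadth-first forest gives exact distances.
  roots-unique : ∀ {i u v} → T (roots k E A i u) → T (roots k E A i v) →
                 Star ⟨ inside E A ⟩ u v → u ≡ v
  roots-unique {i} p q s =
    trans (sym (proj₂ (roots⁻ i p)))
      (trans (cong (centre i) (sep-cong (star⇒R s))) (proj₂ (roots⁻ i q)))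

  root-here : ∀ {i u} → T (A u) → Star ⟨ inside E A ⟩ u (centre i (sep u)) →
              T (roots k E A i (centre i (sep u)))
  root-here {i} {u} a s =
    roots⁺ i (inside-stays {E = E} {A} a s) (cong (centre i) (sym (sep-cong (star⇒R s))))

  -- A walk among survivors stays in one component of G[A], whose vertices share a separator, so it
  -- stays in that component minus its zone, where the balance applies. The bound refers to the
  -- leader because its class is the set for which the separator was sought.
  survivors-halve : ∀ {u} → T (A′ u) → ∃ λ l → T (A l) ×
                    2 * count (components (inside E A′) u) ≤ count (R l)
  survivors-halve {u} p = leader k E A u ,
    inside-stays {E = E} {A} (proj₁ (survivors⁻ p))
      (components-sound (inside E A) (λ {u} {v} → EA-sym {u} {v}) (leader-R u)) ,
    ≤-trans (*-monoʳ-≤ 2 (count-mono {X = components (inside E A′) u}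
                                     {components (inside E Y) u} smaller))
            (balanced⁻ {E = E} {X} {S} (balances (sep-separates u)) {u} Yu)
    where
    X = part k E A u
    S = zone k (sep u)
    Y = X ∖ S

    in-Y : ∀ {v} → ⟨ R ⟩ u v → T (A′ v) → T (Y v)
    in-Y {v} r q = ∖⁺ {X = X} {S} {v} (transi R-eq {leader k E A u} {u} {v} (part-self u) r)
      (subst (λ c → ¬ T (zone k c v)) (sym (sep-cong r)) (proj₂ (survivors⁻ q)))

    Yu : T (Y u)
    Yu = in-Y (reflx R-eq {u}) p

    follow : ∀ {v w} → ⟨ R ⟩ u v → T (A′ v) → Star ⟨ inside E A′ ⟩ v w → Star ⟨ inside E Y ⟩ v w
    follow r q ε = ε
    follow {v} r q (_◅_ {j = x} e s) =
      let _ , q′ , vx = inside⁻ {E = E} {A′} {v} {x} e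
          r′ = transi R-eq {u} {v} {x} r (star⇒R (inside⁺ {E = E} {A} {v} {x}
                 (proj₁ (survivors⁻ q)) (proj₁ (survivors⁻ q′)) vx ◅ ε))
      in inside⁺ {E = E} {Y} {v} {x} (in-Y r q) (in-Y r′ q′) vx ◅ follow r′ q′ s

    smaller : components (inside E A′) u ⊆ᵛ components (inside E Y) u
    smaller {w} q = components-complete (inside E Y) {u} {w} (follow (reflx R-eq {u}) p
      (components-sound (inside E A′)
        (λ {u} {v} → inside-sym {E = E} {A′} (λ {u} {v} → E-sym {u} {v}) {u} {v}) q))

  centre-near : ∀ {u} → T (A u) → ¬ T (A′ u) →
                ∃ λ i → ∃ λ l → l ≤ ρ × Walk ⟨ E ⟩ u (centre i (sep u)) l
  centre-near {u} a ¬p = near (sep-separates u) (removed a ¬p)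

  private
    φ₀ : ∀ i → IsForest _ _
    φ₀ i = bfs-isForest {E = inside E A} (λ {u} {v} → EA-sym {u} {v}) (roots k E A i)

    g : ∀ i → Grows E (bfs (inside E A) (roots k E A i)) (spanner k E A i)
    g i = grow-grows E _ (φ₀ i)

    total : ∀ i x y → ⟨ proj₂ (spanner k E A i) ⟩ x y
    total i x y = grow-joins* E _ (φ₀ i) {x} {y} (walk⇒star (proj₂ (connected G x y)))

  spannerGraph : Fin k → Graph n
  spannerGraph i = forest-graph (forest (g i)) (nonempty G) (total i)

  spannerGraph-spans : ∀ i → IsSpanningTree G (spannerGraph i)
  spannerGraph-spans i = forest-graph-acyclic (forest (g i)) (nonempty G) (total i) , sub
    where
    sub : ∀ {u v} → ⟨ proj₁ (spanner k E A i) ⟩ u v → ⟨ E ⟩ u v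
    sub {u} {v} p with F-new (g i) {u} {v} p
    ... | inj₂ (inj₁ q) = q
    ... | inj₂ (inj₂ q) = E-sym {v} {u} q
    ... | inj₁ q = proj₂ (proj₂ (inside⁻ {E = E} {A} {u} {v} (bfs-⊆ {E = inside E A}
                     (λ {u} {v} → EA-sym {u} {v}) (roots k E A i) {u} {v} q)))

  spannerGraph-near : ∀ {i u x m} → T (A u) → Star ⟨ inside E A ⟩ u (centre i (sep u)) →
                      Walk ⟨ inside E A ⟩ x (centre i (sep u)) m →
                      ∃ λ l → l ≤ m × Walk (Adj (spannerGraph i)) x (centre i (sep u)) l
  spannerGraph-near {i} {u} {x} a s w =
    let l , l≤ , w′ = bfs-shortest {E = inside E A} (λ {u} {v} → EA-sym {u} {v}) (roots k E A i)
                        (roots-unique {i}) (root-here {i} {u} a s) w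
    in l , l≤ , walk-map (λ {x} {y} → F-mono (g i) {x} {y}) w′

-- The hierarchy of separators

layer : ∀ k {n} → Matrix n → Sub n → List (Matrix n) → List (Matrix n)
layer k E A 𝒯 = map (λ i → proj₁ (spanner k E A i)) (allFin k) ++ 𝒯

-- The surrounding loop always makes n rounds. The test for a living vertex keeps idle rounds from
-- adding trees, so that their number is k times the number of active rounds.
level : ∀ k {n} → Matrix n → Sub n × List (Matrix n) → Sub n × List (Matrix n)
level k E (A , 𝒯) = if anyᵛ A then (survivors k E A , layer k E A 𝒯) else (A , 𝒯)

spanners : ∀ k {n} → Matrix n → List (Matrix n)
spanners k {n} E = proj₂ (fold {m = n} (λ _ → level k E) ((λ _ → true) , []))

Leaves : ∀ {n} → Graph n → Sub n → Rel (Fin n) 0ℓ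
Leaves G A u v = T (A u) × Adj G u v

module _ {n} (G : Graph n) where

  private
    E = adj G

    E-sym : ∀ {u v} → ⟨ E ⟩ u v → ⟨ E ⟩ v u
    E-sym {u} {v} = Adj-sym G {u} {v}

  Inside : Sub n → Fin n → Fin n → ℕ → Set
  Inside A = Walk ⟨ inside E A ⟩

  inside⇒leaves : ∀ {A u v l} → Inside A u v l → Walk (Leaves G A) u v l
  inside⇒leaves {A} = walk-map λ {u} {v} e →
    let a , _ , uv = inside⁻ {E = E} {A} {u} {v} e in a , uv

  leaves⇒inside : ∀ {A u v l} → T (A v) → Walk (Leaves G A) u v l → T (A u) × Inside A u v l
  leaves⇒inside a [] = a , []
  leaves⇒inside {A} a (_∷_ {u = u} {v = x} (au , ux) w) =
    let ax , w′ = leaves⇒inside a w in au , inside⁺ {E = E} {A} {u} {x} au ax ux ∷ w′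

  first-exit : ∀ {A u v l} → T (A u) → Walk (Adj G) u v l →
               Inside A u v l ⊎ ∃ λ w → ¬ T (A w) × ∃ λ m → m ≤ l × Walk (Leaves G A) u w m
  first-exit a [] = inj₁ []
  first-exit {A} a (_∷_ {u = u} {v = x} e p) with T? (A x)
  ... | no ¬ax = inj₂ (x , ¬ax , 1 , s≤s z≤n , (a , e) ∷ [])
  ... | yes ax with first-exit ax p
  ...   | inj₁ q = inj₁ (inside⁺ {E = E} {A} {u} {x} a ax e ∷ q)
  ...   | inj₂ (w , ¬aw , m , m≤l , q) = inj₂ (w , ¬aw , suc m , s≤s m≤l , (a , e) ∷ q)

  -- The walk is cut at its first vertex outside `A′`. The second part is reversed so that both
  -- parts run towards this vertex, as `Serves` requires.
  breaks : ∀ {A A′ x y m} → T (A x) → Inside A x y m →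
           (T (A′ x) × Inside A′ x y m) ⊎
           ∃ λ u → T (A u) × ¬ T (A′ u) × ∃₂ λ a b → a + b ≡ m × Inside A x u a × Inside A y u b
  breaks {A} {A′} {x} {y} {m} ax p with T? (A′ x)
  ... | no ¬a′x = inj₂ (x , ax , ¬a′x , 0 , m , refl , [] ,
          walk-reverse (λ {u} {v} → inside-sym {E = E} {A} (λ {u} {v} → E-sym {u} {v}) {u} {v}) p)
  breaks {A} {A′} ax [] | yes a′x = inj₁ (a′x , [])
  breaks {A} {A′} ax (_∷_ {u = x} {v = z} e p) | yes a′x
    with inside⁻ {E = E} {A} {x} {z} e
  ... | _ , az , xz with breaks {A} {A′} az p
  ...   | inj₁ (a′z , q) = inj₁ (a′x , inside⁺ {E = E} {A′} {x} {z} a′x a′z xz ∷ q)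
  ...   | inj₂ (u , au , ¬a′u , a , b , eq , q , r) =
    inj₂ (u , au , ¬a′u , suc a , b , cong suc eq , e ∷ q , r)

  -- w itself need not lie in A: only the steps towards it have to start in A.
  Serves : Sub n → Fin n → ℕ → Graph n → Set
  Serves A w q T = ∃ λ v → ∀ {x m} → Walk (Leaves G A) x w m →
                   ∃ λ l → l ≤ m + q × Walk (Adj T) x v l

  Joins : Fin n → Fin n → ℕ → Graph n → Set
  Joins x y q T = ∃ λ l → l ≤ q × Walk (Adj T) x y l

  -- Here ℓ counts the active rounds. Once `A` is empty `small` says nothing about ℓ, so `power` is
  -- kept beside it: a round is active only if a vertex is alive, which forces `2 ^ ℓ ≤ n` before
  -- the round and `2 ^ suc ℓ ≤ 2 * n` after it. This last round is the 1 in 1 + log₂ n.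
  record Levels (k ρ ℓ : ℕ) (A : Sub n) (𝒯 : List (Graph n)) : Set where
    field
      small    : ∀ {u} → T (A u) → count (components (inside E A) u) * 2 ^ ℓ ≤ n
      power    : 2 ^ ℓ ≤ 2 * n
      amount   : length 𝒯 ≡ k * ℓ
      spanning : All (IsSpanningTree G) 𝒯
      served   : ∀ {w} → ¬ T (A w) → Any (Serves A w (ρ * ℓ)) 𝒯
      joined   : ∀ {x y m} → Walk (Adj G) x y m →
                 (T (A x) × Inside A x y m) ⊎ Any (Joins x y (m + 2 * (ρ * ℓ))) 𝒯

  open Levels

  small⇒≤ : ∀ {ℓ A u} → count (components (inside E A) u) * 2 ^ ℓ ≤ n → 2 ^ ℓ ≤ n
  small⇒≤ {ℓ} {A} {u} bound = begin
    2 ^ ℓ                                       ≡⟨ *-identityˡ (2 ^ ℓ) ⟨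
    1 * 2 ^ ℓ                                   ≤⟨ *-monoˡ-≤ (2 ^ ℓ) nonempty-component ⟩
    count (components (inside E A) u) * 2 ^ ℓ   ≤⟨ bound ⟩
    n                                           ∎
    where
    open ≤-Reasoning
    nonempty-component : 1 ≤ count (components (inside E A) u)
    nonempty-component = count-nonempty {X = components (inside E A) u} {u}
                           (reflx (components-isEquiv (inside E A)) {u})

  module _ {k ρ ℓ : ℕ} {A : Sub n} {𝒯 : List (Graph n)} (L : Levels k ρ ℓ A 𝒯)
           (separator : ∀ X → ∃ λ c → search E X k ≡ just c × Separates E X ρ {k} c) where

    private
      A′ = survivors k E A

      A′⊆A : A′ ⊆ᵛ A
      A′⊆A p = proj₁ (survivors⁻ G A separator p)

      new = map (spannerGraph G A separator) (allFin k)

      grow-q : ∀ {a b} → b ≤ a + ρ * ℓ → ∀ {r} → r ≤ ρ → b + r ≤ a + ρ * suc ℓ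
      grow-q {a} {b} p {r} q = begin
        b + r             ≤⟨ +-mono-≤ p q ⟩
        a + ρ * ℓ + ρ     ≡⟨ +-assoc a (ρ * ℓ) ρ ⟩
        a + (ρ * ℓ + ρ)   ≡⟨ cong (a +_) (trans (+-comm (ρ * ℓ) ρ) (sym (*-suc ρ ℓ))) ⟩
        a + ρ * suc ℓ     ∎
        where open ≤-Reasoning

      slower : ∀ {w} → ¬ T (A w) → Any (Serves A w (ρ * suc ℓ)) 𝒯
      slower ¬aw = Any.map
        (λ { (v , f) → v , λ {x} {m} p → let l , l≤ , q = f p in
             l , ≤-trans l≤ (+-monoʳ-≤ m (*-monoʳ-≤ ρ (n≤1+n ℓ))) , q })
        (served L ¬aw)

      removed-served : ∀ {u} → T (A u) → ¬ T (A′ u) → Any (Serves A u (ρ * suc ℓ)) (new ++ 𝒯)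
      removed-served {u} au ¬a′u with centre-near G A separator au ¬a′u
      ... | i , l , l≤ρ , w with first-exit {A} au w
      ...   | inj₁ p = Any.++⁺ˡ (Any.map⁺ (Any.map (λ { refl → serve }) (∈-allFin i)))
        where
        serve : Serves A u (ρ * suc ℓ) (spannerGraph G A separator i)
        serve = _ , λ {x} {m} q →
          let l′ , l′≤ , t = spannerGraph-near G A separator {i} au (walk⇒star p)
                               (proj₂ (leaves⇒inside {A} au q) ++ʷ p)
          in l′ , ≤-trans l′≤ (grow-q {m} (m≤m+n m (ρ * ℓ)) l≤ρ) , t
      -- Since `p` stops at the first dead vertex `w′`, the walk `q` followed by `p` still leaves
      -- only living vertices, as the older tree serving `w′` demands.
      ...   | inj₂ (w′ , ¬aw , m′ , m′≤ , p) = Any.++⁺ʳ new (Any.map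
        (λ { (v , f) → v , λ {x} {m} q → let l′ , l′≤ , t = f (q ++ʷ p) in
             l′ , ≤-trans l′≤ (≤-trans (≤-reflexive (shuffle m m′ (ρ * ℓ)))
                                       (grow-q {m} ≤-refl (≤-trans m′≤ l≤ρ))) , t })
        (served L ¬aw))
        where
        shuffle : ∀ a b c → a + b + c ≡ a + c + b
        shuffle = solve-∀

      served-A : ∀ {w} → ¬ T (A′ w) → Any (Serves A w (ρ * suc ℓ)) (new ++ 𝒯)
      served-A {w} ¬a′w with T? (A w)
      ... | yes aw = removed-served aw ¬a′w
      ... | no ¬aw = Any.++⁺ʳ new (slower ¬aw)

      join : ∀ {x y u a b} → Inside A x u a → Inside A y u b →
             ∀ {T} → Serves A u (ρ * suc ℓ) T → Joins x y (a + b + 2 * (ρ * suc ℓ)) T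
      join {a = a} {b} p q {T} (v , f) =
        let l , l≤ , t = f (inside⇒leaves p)
            l′ , l′≤ , t′ = f (inside⇒leaves q)
        in l + l′ ,
           ≤-trans (+-mono-≤ l≤ l′≤) (≤-reflexive (shuffle a b (ρ * suc ℓ))) ,
           t ++ʷ walk-reverse (λ {u} {v} → Adj-sym T {u} {v}) t′
        where
        shuffle : ∀ a b c → a + c + (b + c) ≡ a + b + 2 * c
        shuffle = solve-∀

      joined′ : ∀ {x y m} → Walk (Adj G) x y m →
                (T (A′ x) × Inside A′ x y m) ⊎ Any (Joins x y (m + 2 * (ρ * suc ℓ))) (new ++ 𝒯)
      joined′ {x} {y} {m} w with joined L w
      ... | inj₂ j = inj₂ (Any.++⁺ʳ new (Any.map
              (λ { (l , l≤ , t) → l ,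
                   ≤-trans l≤ (+-monoʳ-≤ m (*-monoʳ-≤ 2 (*-monoʳ-≤ ρ (n≤1+n ℓ)))) , t }) j))
      ... | inj₁ (ax , p) with breaks {A} {A′} ax p
      ...   | inj₁ q = inj₁ q
      ...   | inj₂ (u , au , ¬a′u , a , b , refl , q , r) =
        inj₂ (Any.map (λ {T} → join q r {T}) (removed-served au ¬a′u))

    next-levels : ∀ {u} → T (A u) → Levels k ρ (suc ℓ) A′ (new ++ 𝒯)
    next-levels au .power = *-monoʳ-≤ 2 (small⇒≤ {ℓ} {A} (small L au))
    next-levels _ .small {u} p =
      let l , al , h = survivors-halve G A separator {u} p in begin
      c * (2 * 2 ^ ℓ)                             ≡⟨ shuffle c (2 ^ ℓ) ⟩
      2 * c * 2 ^ ℓ                               ≤⟨ *-monoˡ-≤ (2 ^ ℓ) h ⟩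
      count (components (inside E A) l) * 2 ^ ℓ   ≤⟨ small L al ⟩
      n                                           ∎
      where
      open ≤-Reasoning
      c = count (components (inside E A′) u)
      shuffle : ∀ a b → a * (2 * b) ≡ 2 * a * b
      shuffle = solve-∀
    next-levels _ .amount = begin
      length (new ++ 𝒯)       ≡⟨ length-++ new ⟩
      length new + length 𝒯   ≡⟨ cong₂ _+_ length-new (amount L) ⟩
      k + k * ℓ               ≡⟨ *-suc k ℓ ⟨
      k * suc ℓ               ∎
      where
      open ≡-Reasoning
      length-new : length new ≡ k
      length-new = trans (length-map _ (allFin k)) (length-tabulate {n = k} id)
    next-levels _ .spanning = All.++⁺
      (All.map⁺ (All.universal (spannerGraph-spans G A separator) (allFin k)))
      (spanning L)
    -- The trees serve walks through all of `A`; walks through the smaller `A′` are among these.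
    next-levels _ .served ¬a′w = Any.map
      (λ { (v , f) → v , λ {x} {m} p → f (walk-map (λ { (a , e) → A′⊆A a , e }) p) })
      (served-A ¬a′w)
    next-levels _ .joined = joined′

    next-layer : map adj (new ++ 𝒯) ≡ layer k E A (map adj 𝒯)
    next-layer = trans (map-++ adj new 𝒯) (cong (_++ map adj 𝒯) (sym (map-∘ (allFin k))))

  first-level : ∀ {k ρ} → Levels k ρ 0 (λ _ → true) []
  first-level {k} = record
    { small    = λ {u} _ → subst (_≤ n) (sym (*-identityʳ _))
                   (count-≤ (components (inside E (λ _ → true)) u))
    ; power    = ≤-trans (m^n>0 n {{nonempty G}} 1)
                   (≤-trans (≤-reflexive (*-identityʳ n)) (m≤m+n n (n + 0)))
    ; amount   = sym (*-zeroʳ k)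
    ; spanning = []
    ; served   = λ ¬t → contradiction _ ¬t
    ; joined   = λ w → inj₁ (_ , walk-map id w)
    }

  n<2^n : ∀ m → m < 2 ^ m
  n<2^n zero    = s≤s z≤n
  n<2^n (suc m) = ≤-trans (s≤s (n<2^n m))
    (+-mono-≤ (m^n>0 2 m) (≤-reflexive (sym (+-identityʳ (2 ^ m)))))

  -- Raising the hypothesis to the power `c` before taking logarithms matches a bound that is
  -- rounded only after the multiplication. It is applied with `k` for the number of trees and with
  -- `2 * ρ` for the stretch.
  log-bound : ∀ c ℓ → 2 ^ ℓ ≤ 2 * n → c * ℓ ≤ ⌊ c ·[1+log₂ n ]⌋
  log-bound c ℓ p = begin
    c * ℓ                     ≡⟨ ⌊log₂[2^n]⌋≡n (c * ℓ) ⟨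
    ⌊log₂ 2 ^ (c * ℓ) ⌋       ≡⟨ cong (λ e → ⌊log₂ 2 ^ e ⌋) (*-comm c ℓ) ⟩
    ⌊log₂ 2 ^ (ℓ * c) ⌋       ≡⟨ cong ⌊log₂_⌋ (^-*-assoc 2 ℓ c) ⟨
    ⌊log₂ (2 ^ ℓ) ^ c ⌋       ≤⟨ ⌊log₂⌋-mono-≤ (^-monoˡ-≤ c p) ⟩
    ⌊log₂ (2 * n) ^ c ⌋       ∎
    where open ≤-Reasoning

  module _ {k ρ} (separator : ∀ X → ∃ λ c → search E X k ≡ just c × Separates E X ρ {k} c) where

    -- The program lists bare matrices while the proof needs graphs, and `map adj` ties the two
    -- together. The last component says that every round so far was active as long as some vertex
    -- is alive.
    LevelInvariant : ℕ → Sub n × List (Matrix n) → Set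
    LevelInvariant i (A , ts) = ∃₂ λ ℓ 𝒯 → Levels k ρ ℓ A 𝒯 × map adj 𝒯 ≡ ts × (T (anyᵛ A) → ℓ ≡ i)

    level-progress : ∀ i s → LevelInvariant i s → LevelInvariant (suc i) (level k E s)
    level-progress i (A , _) (ℓ , 𝒯 , L , refl , active) = if⁻ (LevelInvariant (suc i)) (anyᵛ A)
      (λ some → let u , au = anyᵛ⁻ A some in
        suc ℓ , _ , next-levels L separator au , next-layer L separator ,
        λ _ → cong suc (active some))
      (λ none → ℓ , 𝒯 , L , refl , λ some → contradiction some none)

    spanners-collective : ∃ λ 𝒯 → map adj 𝒯 ≡ spanners k E ×
      IsCollectiveTreeSpanners G ⌊ k ·[1+log₂ n ]⌋ ⌊ (2 * ρ) ·[1+log₂ n ]⌋ 𝒯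
    spanners-collective
      with fold-counts LevelInvariant {n} (λ _ → level k E) (λ _ → level-progress)
             ((λ _ → true) , []) (0 , [] , first-level , refl , λ _ → refl)
    ... | ℓ , 𝒯 , L , eq , active = 𝒯 , eq , record
      { bounded  = ≤-trans (≤-reflexive (amount L)) (log-bound k ℓ (power L))
      ; spanning = spanning L
      ; stretch  = λ x y → Any.map (λ {T} → short x y {T}) (reach x y)
      }
      where
      A = proj₁ (fold {m = n} (λ _ → level k E) ((λ _ → true) , []))

      empty : ∀ {u} → ¬ T (A u)
      -- A vertex alive at the end would make all n rounds active, so that `2 ^ n ≤ n`.
      empty {u} au with active (anyᵛ⁺ A au)
      ... | refl = contradiction (small⇒≤ {n} {A} (small L au)) (<⇒≱ (n<2^n n))

      reach : ∀ x y → Any (Joins x y (dist G x y + 2 * (ρ * ℓ))) 𝒯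
      reach x y with joined L (proj₁ (dist-isMinimum G x y))
      ... | inj₁ (ax , _) = contradiction ax empty
      ... | inj₂ j = j

      short : ∀ x y {T} → Joins x y (dist G x y + 2 * (ρ * ℓ)) T →
              dist T x y ≤ dist G x y + ⌊ (2 * ρ) ·[1+log₂ n ]⌋
      short x y {T} (l , l≤ , w) = ≤-trans (dist≤ T w) (≤-trans l≤ (+-monoʳ-≤ (dist G x y)
        (≤-trans (≤-reflexive (sym (*-assoc 2 ρ ℓ))) (log-bound (2 * ρ) ℓ (power L)))))

-- The algorithm as a program

setᵗ matrixᵗ forestᵗ : Ty
setᵗ    = table bool
matrixᵗ = table setᵗ
forestᵗ = matrixᵗ ×ᵗ matrixᵗ

equalᶠ : ∀ {Γ} → Fun Γ matrixᵗ
equalᶠ = tabulateᶠ (tabulateᶠ (var #1 ≟ᶠ var #0))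

startᶠ : ∀ {Γ} → Fun Γ forestᵗ
startᶠ = tabulateᶠ (tabulateᶠ falseᶠ) ,ᶠ equalᶠ

-- The predicate is tabulated before the fold because a fold places its accumulator between the
-- vertex and Γ, where `F` does not expect it.
anyᶠ : ∀ {Γ} → Fun (vertex ∷ Γ) bool → Fun Γ bool
anyᶠ F = call {Δ = setᵗ ∷ []} (foldᶠ (var #2 at var #0 ∨ᶠ var #1) falseᶠ) (tabulateᶠ F ∷ [])

linkᶠ : Fun (vertex ∷ vertex ∷ matrixᵗ ∷ []) matrixᵗ
linkᶠ = tabulateᶠ (tabulateᶠ (var #4 at var #1 at var #0
  ∨ᶠ (var #4 at var #1 at var #2 ∧ᶠ var #4 at var #3 at var #0)
  ∨ᶠ (var #4 at var #1 at var #3 ∧ᶠ var #4 at var #2 at var #0)))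

insertᶠ : Fun (vertex ∷ vertex ∷ matrixᵗ ∷ []) matrixᵗ
insertᶠ = tabulateᶠ (tabulateᶠ (var #4 at var #1 at var #0
  ∨ᶠ (var #1 ≟ᶠ var #2 ∧ᶠ var #0 ≟ᶠ var #3)
  ∨ᶠ (var #1 ≟ᶠ var #3 ∧ᶠ var #0 ≟ᶠ var #2)))

addᶠ : Fun (matrixᵗ ∷ vertex ∷ vertex ∷ forestᵗ ∷ []) forestᵗ
addᶠ = ifᶠ var #0 at var #1 at var #2 ∧ᶠ notᶠ (snd (var #3) at var #1 at var #2)
  then (call insertᶠ (var #1 ∷ var #2 ∷ fst (var #3) ∷ [])
     ,ᶠ call linkᶠ (var #1 ∷ var #2 ∷ snd (var #3) ∷ []))
  else var #3

growᶠ : Fun (matrixᵗ ∷ forestᵗ ∷ []) forestᵗ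
growᶠ = foldᶠ (foldᶠ (call addᶠ (var #4 ∷ var #2 ∷ var #0 ∷ var #1 ∷ [])) (var #1)) (var #1)

componentsᶠ : Fun (matrixᵗ ∷ []) matrixᵗ
componentsᶠ = snd (call growᶠ (var #0 ∷ startᶠ ∷ []))

expandᶠ : Fun (matrixᵗ ∷ setᵗ ∷ []) setᵗ
expandᶠ = tabulateᶠ (var #2 at var #0 ∨ᶠ anyᶠ (var #3 at var #0 ∧ᶠ var #2 at var #0 at var #1))

frontierᶠ : Fun (matrixᵗ ∷ setᵗ ∷ []) matrixᵗ
frontierᶠ = tabulateᶠ (tabulateᶠ
  (var #3 at var #1 ∧ᶠ notᶠ (var #3 at var #0) ∧ᶠ var #2 at var #1 at var #0))

sweepᶠ : Fun (matrixᵗ ∷ (forestᵗ ×ᵗ setᵗ) ∷ []) (forestᵗ ×ᵗ setᵗ)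
sweepᶠ = call growᶠ (call frontierᶠ (var #0 ∷ snd (var #1) ∷ []) ∷ fst (var #1) ∷ [])
      ,ᶠ call expandᶠ (var #0 ∷ snd (var #1) ∷ [])

bfsᶠ : Fun (matrixᵗ ∷ setᵗ ∷ []) forestᵗ
bfsᶠ = fst (foldᶠ (call sweepᶠ (var #2 ∷ var #1 ∷ [])) (startᶠ ,ᶠ var #1))

halfᶠ : Fun (setᵗ ∷ setᵗ ∷ []) bool
halfᶠ = isZeroᶠ (foldᶠ (ifᶠ var #3 at var #0 then predᶠ (var #1) else var #1)
                  (foldᶠ (ifᶠ var #2 at var #0 then sucᶠ (sucᶠ (var #1)) else var #1) zeroᶠ))

insideᶠ : Fun (matrixᵗ ∷ setᵗ ∷ []) matrixᵗ
insideᶠ = tabulateᶠ (tabulateᶠ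
  (var #3 at var #1 ∧ᶠ var #3 at var #0 ∧ᶠ var #2 at var #1 at var #0))

_∖ᶠ_ : ∀ {Γ} → Fun Γ setᵗ → Fun Γ setᵗ → Fun Γ setᵗ
F ∖ᶠ F′ = call {Δ = setᵗ ∷ setᵗ ∷ []}
  (tabulateᶠ (var #1 at var #0 ∧ᶠ notᶠ (var #2 at var #0))) (F ∷ F′ ∷ [])

balancedᶠ : Fun (matrixᵗ ∷ setᵗ ∷ setᵗ ∷ []) bool
balancedᶠ = notᶠ (anyᶠ ((var #2 ∖ᶠ var #3) at var #0 ∧ᶠ notᶠ (call halfᶠ
  (call componentsᶠ (call insideᶠ (var #1 ∷ (var #2 ∖ᶠ var #3) ∷ []) ∷ []) at var #0
   ∷ var #2 ∷ []))))

mutual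
  -- The recursion on `k` takes place outside the programs and unrolls into k nested loops over the
  -- vertices, so the exponent depends on `k`. Revaluing at every depth makes the inner call
  -- definitionally `try`, and both cases of `tryBody-value` become `refl`.
  tryᶠ : ∀ k → Fun (setᵗ ∷ matrixᵗ ∷ setᵗ ∷ matrixᵗ ∷ []) (maybe (candidate k))
  tryᶠ k = revalue (tryBody k) (λ { (S , M , X , E , _) → try E X M k S }) (tryBody-value k)

  tryBody : ∀ k → Fun (setᵗ ∷ matrixᵗ ∷ setᵗ ∷ matrixᵗ ∷ []) (maybe (candidate k))
  tryBody zero =
    ifᶠ call balancedᶠ (var #3 ∷ var #2 ∷ var #0 ∷ []) then justᶠ (var #0) else nothingᶠ
  tryBody (suc k) = foldᶠ
    (maybeᶠ (justᶠ (var #0)) (var #1)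
      (maybeᶠ (justᶠ (var #1 ,ᶠ var #0)) nothingᶠ
        (call (tryᶠ k) (tabulateᶠ (var #3 at var #0 ∨ᶠ var #4 at var #1 at var #0)
                        ∷ var #3 ∷ var #4 ∷ var #5 ∷ []))))
    nothingᶠ

  tryBody-value : ∀ k {n} (γ : Env _ n) → value (tryBody k) γ ≡ _
  tryBody-value zero    γ = refl
  tryBody-value (suc k) γ = refl

attemptᶠ : ∀ k → Fun (matrixᵗ ∷ setᵗ ∷ (matrixᵗ ×ᵗ maybe (candidate k)) ∷ [])
                     (matrixᵗ ×ᵗ maybe (candidate k))
attemptᶠ k = tabulateᶠ (call expandᶠ (var #1 ∷ fst (var #3) at var #0 ∷ []))
  ,ᶠ maybeᶠ (justᶠ (var #0))
       (call (tryᶠ k) (tabulateᶠ falseᶠ ∷ fst (var #2) ∷ var #1 ∷ var #0 ∷ []))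
       (snd (var #2))

searchᶠ : ∀ k → Fun (matrixᵗ ∷ setᵗ ∷ []) (maybe (candidate k))
searchᶠ k = snd (foldᶠ (call (attemptᶠ k) (var #2 ∷ var #3 ∷ var #1 ∷ [])) (equalᶠ ,ᶠ nothingᶠ))

firstᶠ : Fun (setᵗ ∷ vertex ∷ []) vertex
firstᶠ = foldᶠ (ifᶠ var #2 at var #0 then var #0 else var #1) (var #1)

leaderᶠ : Fun (matrixᵗ ∷ setᵗ ∷ vertex ∷ []) vertex
leaderᶠ = call firstᶠ
  (call componentsᶠ (call insideᶠ (var #0 ∷ var #1 ∷ []) ∷ []) at var #2 ∷ var #2 ∷ [])

choiceᶠ : ∀ k → Fun (matrixᵗ ∷ setᵗ ∷ vertex ∷ []) (maybe (candidate k))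
choiceᶠ k = call (searchᶠ k) (var #0 ∷
  call componentsᶠ (call insideᶠ (var #0 ∷ var #1 ∷ []) ∷ []) at leaderᶠ ∷ [])

zoneOf : ∀ k {Γ} → Fun Γ (candidate k) → Fun Γ setᵗ
zoneOf zero    F = F
zoneOf (suc k) F = zoneOf k (snd F)

zoneOf-value : ∀ k {Γ} (F : Fun Γ (candidate k)) {n} (γ : Env Γ n) →
               value (zoneOf k F) γ ≡ zone k (value F γ)
zoneOf-value zero    F γ = refl
zoneOf-value (suc k) F γ = zoneOf-value k (snd F) γ

zoneᶠ : ∀ k → Fun (candidate k ∷ []) setᵗ
zoneᶠ k = revalue (zoneOf k (var #0)) (λ γ → zone k (proj₁ γ)) (zoneOf-value k (var #0))

centreOf : ∀ {k} → Fin k → ∀ {Γ} → Fun Γ (candidate k) → Fun Γ vertex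
centreOf zero    F = fst F
centreOf (suc i) F = centreOf i (snd F)

centreOf-value : ∀ {k} (i : Fin k) {Γ} (F : Fun Γ (candidate k)) {n} (γ : Env Γ n) →
                 value (centreOf i F) γ ≡ centre i (value F γ)
centreOf-value zero    F γ = refl
centreOf-value (suc i) F γ = centreOf-value i (snd F) γ

centreᶠ : ∀ {k} → Fin k → Fun (candidate k ∷ []) vertex
centreᶠ i = revalue (centreOf i (var #0)) (λ γ → centre i (proj₁ γ)) (centreOf-value i (var #0))

survivorsᶠ : ∀ k → Fun (matrixᵗ ∷ setᵗ ∷ []) setᵗ
survivorsᶠ k = tabulateᶠ (var #2 at var #0 ∧ᶠ
  maybeᶠ (notᶠ (call (zoneᶠ k) (var #0 ∷ []) at var #1)) falseᶠ
         (call (choiceᶠ k) (var #1 ∷ var #2 ∷ var #0 ∷ [])))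

rootsᶠ : ∀ k → Fin k → Fun (matrixᵗ ∷ setᵗ ∷ []) setᵗ
rootsᶠ k i = tabulateᶠ (var #2 at var #0 ∧ᶠ
  maybeᶠ (call (centreᶠ i) (var #0 ∷ []) ≟ᶠ var #1) falseᶠ
         (call (choiceᶠ k) (var #1 ∷ var #2 ∷ var #0 ∷ [])))

spannerᶠ : ∀ k → Fin k → Fun (matrixᵗ ∷ setᵗ ∷ []) forestᵗ
spannerᶠ k i = call growᶠ (var #0 ∷
  call bfsᶠ (call insideᶠ (var #0 ∷ var #1 ∷ []) ∷ rootsᶠ k i ∷ []) ∷ [])

spannersOf : ∀ k → List (Fin k) → Fun (matrixᵗ ∷ setᵗ ∷ list matrixᵗ ∷ []) (list matrixᵗ)
spannersOf k []       = var #2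
spannersOf k (i ∷ is) = fst (call (spannerᶠ k i) (var #0 ∷ var #1 ∷ [])) ∷ᶠ spannersOf k is

spannersOf-value : ∀ k is {n} (E : Matrix n) A 𝒯 → value (spannersOf k is) (E , A , 𝒯 , tt) ≡
                   map (λ i → proj₁ (spanner k E A i)) is ++ 𝒯
spannersOf-value k []       E A 𝒯 = refl
spannersOf-value k (i ∷ is) E A 𝒯 = cong (_ ∷_) (spannersOf-value k is E A 𝒯)

layerᶠ : ∀ k → Fun (matrixᵗ ∷ setᵗ ∷ list matrixᵗ ∷ []) (list matrixᵗ)
layerᶠ k = revalue (spannersOf k (allFin k)) (λ { (E , A , 𝒯 , _) → layer k E A 𝒯 })
                   (λ { (E , A , 𝒯 , _) → spannersOf-value k (allFin k) E A 𝒯 })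

levelᶠ : ∀ k → Fun (matrixᵗ ∷ (setᵗ ×ᵗ list matrixᵗ) ∷ []) (setᵗ ×ᵗ list matrixᵗ)
levelᶠ k = ifᶠ anyᶠ (fst (var #2) at var #0)
  then (call (survivorsᶠ k) (var #0 ∷ fst (var #1) ∷ [])
     ,ᶠ call (layerᶠ k) (var #0 ∷ fst (var #1) ∷ snd (var #1) ∷ []))
  else var #1

spannersᶠ : ∀ k → Fun (matrixᵗ ∷ []) (list matrixᵗ)
spannersᶠ k = revalue
  (snd (foldᶠ (call (levelᶠ k) (var #2 ∷ var #1 ∷ [])) (tabulateᶠ trueᶠ ,ᶠ []ᶠ)))
  (λ { (E , _) → spanners k E }) (λ _ → refl)

encodeGraphs-adj : ∀ {n} (𝒯 : List (Graph n)) → encode (list matrixᵗ) (map adj 𝒯) ≡ encodeGraphs 𝒯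
encodeGraphs-adj []      = refl
encodeGraphs-adj (T ∷ 𝒯) = cong (encodeGraph T ∙_) (encodeGraphs-adj 𝒯)

-- After `measure` the register holds an environment with the matrix as its only entry, on top of an
-- empty stack; the final `hd` discards that stack.
algorithm : ℕ → Routine
algorithm k = measure then code (spannersᶠ k) then assignment (hd reg)

algorithm-halts : ∀ k {n} (G : Graph n) →
                  Halts (algorithm k) n (encodeGraph G) (encode (list matrixᵗ) (spanners k (adj G)))
algorithm-halts k {n} G =
  measure-halts (map _ (allFin n)) (trans (length-map _ (allFin n)) (length-tabulate id))
    then-halts run (correct (spannersᶠ k) (adj G , tt)) nil
    then-halts assignment-halts (hd reg)
  where instance
    n≢0 = nonempty G

theorem7 : ∀ (k : ℕ) → 1 ≤ k →
    ∃ λ (A : Program) → ∃₂ λ (C e : ℕ) →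
    ∀ (ρ : ℕ) {n : ℕ} (G : Graph n) →
    (∃ λ t → IsTreeBreadth k G t × t ≤ ρ) →
    ∃ λ (𝒯 : List (Graph n)) →
    IsCollectiveTreeSpanners G ⌊ k ·[1+log₂ n ]⌋ ⌊ (2 * ρ) ·[1+log₂ n ]⌋ 𝒯
    × (A ⊢ encodeGraph G ⇓ encodeGraphs 𝒯 within (C * n ^ e))
theorem7 k _ = program (algorithm k) , factor (algorithm k) , exponent (algorithm k) ,
  -- The program and its time bound are fixed before `ρ` appears: `ρ` enters only through the proof
  -- that the radii found are at most `ρ`.
  λ ρ G tb →
    let 𝒯 , eq , collective = spanners-collective G (search-separates G tb)
        halts t≤ p = algorithm-halts k G
    in 𝒯 , collective , _ , t≤ ,
       subst (λ v → program (algorithm k) ⊢ encodeGraph G ⇓ v [ _ ])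
             (trans (cong (encode (list matrixᵗ)) (sym eq)) (encodeGraphs-adj 𝒯)) p
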